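{- Let $n\ge 2$ be an integer and let $K_n$ be the complete graph on $n$ vertices. Then: (i) the Randić characteristic polynomial of $K_n$ is $RP(K_n,\lambda)=(\lambda-1)\left(\lambda+\frac{1}{n-1}\right)^{n-1}$; (ii) the Randić energy of $K_n$ is $RE(K_n)=2$.
   Context: All graphs are finite and simple. For a graph $G$ with vertices $v_1,\dots,v_n$ of degrees $d_1,\dots,d_n$, the Randić matrix $R(G)$ is the $n\times n$ real symmetric matrix with $(i,j)$-entry $\frac{1}{\sqrt{d_id_j}}$ if $v_i$ and $v_j$ are adjacent, and $0$ otherwise. The Randić characteristic polynomial of $G$ is $RP(G,\lambda)=\det(\lambda I-R(G))$. The Randić energy of $G$ is $RE(G)=\sum_{i=1}^n|\rho_i|$, where $\rho_1,\dots,\rho_n$ are the eigenvalues of $R(G)$ counted with multiplicity. -}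

module Defs where

open import Level using (0ℓ)
open import Algebra.Bundles using (CommutativeRing; Semiring)
open import Algebra.Structures using (IsCommutativeRing)
open import Data.Fin.Base using (Fin; zero; suc; toℕ; punchIn)
import Data.Fin.Properties as Fin
import Data.Integer.Base as ℤ
import Data.Integer.Properties as ℤ
open import Data.List.Base using (length; filter; allFin)
open import Data.List.Membership.Propositional.Properties using (∈-filter⁺; ∈-allFin; ∈-length)
open import Data.Nat.Base as ℕ using (ℕ; zero; suc)
import Data.Nat.Properties as ℕ
open import Data.Product.Base using (∃; _×_; _,_; proj₁; proj₂)
open import Data.Rational.Base as ℚ using (ℚ; 0ℚ; 1ℚ; ½; toℚᵘ)
import Data.Rational.Properties as ℚ
open import Data.Rational.Solver using (module +-*-Solver)
import Data.Rational.Unnormalised.Base as ℚᵘ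
import Data.Rational.Unnormalised.Properties as ℚᵘ
open import Data.Sum.Base using (inj₁; inj₂)
open import Data.Vec.Functional using (Vector)
open import Function.Base using (_∘_)
open import Relation.Binary.Core using (Rel)
open import Relation.Binary.Definitions using (Decidable; Symmetric; Irreflexive)
open import Relation.Binary.PropositionalEquality
open import Relation.Binary.Structures using (IsEquivalence)
open import Relation.Nullary using (yes; no; ¬?; contradiction)

------------------------------------------------------------------------
-- Auxiliary facts about rationals

module RationalLemmas where

  private
    variable
      p q δ : ℚ

  ∣p-q∣≡∣q-p∣ : ∀ p q → ℚ.∣ p ℚ.- q ∣ ≡ ℚ.∣ q ℚ.- p ∣
  ∣p-q∣≡∣q-p∣ p q = trans (sym (ℚ.∣-p∣≡∣p∣ (p ℚ.- q)))
    (cong ℚ.∣_∣ (solve 2 (λ a b → :- (a :- b) := b :- a) refl p q))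
    where
    open +-*-Solver

  ∣p-p∣≡0 : ∀ p → ℚ.∣ p ℚ.- p ∣ ≡ 0ℚ
  ∣p-p∣≡0 p = cong ℚ.∣_∣ (ℚ.+-inverseʳ p)

  triangle : ∀ p q r → ℚ.∣ p ℚ.- r ∣ ℚ.≤ ℚ.∣ p ℚ.- q ∣ ℚ.+ ℚ.∣ q ℚ.- r ∣
  triangle p q r = subst (ℚ._≤ ℚ.∣ p ℚ.- q ∣ ℚ.+ ℚ.∣ q ℚ.- r ∣)
    (cong ℚ.∣_∣ (solve 3 (λ a b c → (a :- b) :+ (b :- c) := a :- c) refl p q r))
    (ℚ.∣p+q∣≤∣p∣+∣q∣ (p ℚ.- q) (q ℚ.- r))
    where
    open +-*-Solver

  p≤∣p∣ : ∀ p → p ℚ.≤ ℚ.∣ p ∣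
  p≤∣p∣ p with ℚ.≤-total 0ℚ p
  ... | inj₁ 0≤p = ℚ.≤-reflexive (sym (ℚ.0≤p⇒∣p∣≡p 0≤p))
  ... | inj₂ p≤0 = ℚ.≤-trans p≤0 (ℚ.0≤∣p∣ p)

  ∣p∣<q : p ℚ.< q → ℚ.- p ℚ.< q → ℚ.∣ p ∣ ℚ.< q
  ∣p∣<q {p} p<q -p<q with ℚ.∣p∣≡p∨∣p∣≡-p p
  ... | inj₁ eq = subst (ℚ._< _) (sym eq) p<q
  ... | inj₂ eq = subst (ℚ._< _) (sym eq) -p<q

  ∣p∣-∣q∣≤∣p-q∣ : ∀ p q → ℚ.∣ p ∣ ℚ.- ℚ.∣ q ∣ ℚ.≤ ℚ.∣ p ℚ.- q ∣
  ∣p∣-∣q∣≤∣p-q∣ p q = subst (ℚ.∣ p ∣ ℚ.- ℚ.∣ q ∣ ℚ.≤_)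
    (solve 2 (λ a b → (a :+ b) :- b := a) refl ℚ.∣ p ℚ.- q ∣ ℚ.∣ q ∣)
    (ℚ.+-monoˡ-≤ (ℚ.- ℚ.∣ q ∣) (subst (λ t → ℚ.∣ t ∣ ℚ.≤ ℚ.∣ p ℚ.- q ∣ ℚ.+ ℚ.∣ q ∣)
      (solve 2 (λ a b → (a :- b) :+ b := a) refl p q)
      (ℚ.∣p+q∣≤∣p∣+∣q∣ (p ℚ.- q) q)))
    where
    open +-*-Solver

  ∣∣p∣-∣q∣∣≤∣p-q∣ : ∀ p q → ℚ.∣ ℚ.∣ p ∣ ℚ.- ℚ.∣ q ∣ ∣ ℚ.≤ ℚ.∣ p ℚ.- q ∣
  ∣∣p∣-∣q∣∣≤∣p-q∣ p q with ℚ.∣p∣≡p∨∣p∣≡-p (ℚ.∣ p ∣ ℚ.- ℚ.∣ q ∣)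
  ... | inj₁ eq = subst (ℚ._≤ ℚ.∣ p ℚ.- q ∣) (sym eq) (∣p∣-∣q∣≤∣p-q∣ p q)
  ... | inj₂ eq = subst₂ ℚ._≤_
      (trans (solve 2 (λ a b → b :- a := :- (a :- b)) refl ℚ.∣ p ∣ ℚ.∣ q ∣) (sym eq))
      (∣p-q∣≡∣q-p∣ q p) (∣p∣-∣q∣≤∣p-q∣ q p)
    where
    open +-*-Solver

  half>0 : 0ℚ ℚ.< p → 0ℚ ℚ.< ½ ℚ.* p
  half>0 {p} 0<p = ℚ.positive⁻¹ (½ ℚ.* p)
    {{ℚ.pos*pos⇒pos ½ p {{ℚ.positive 0<p}}}}

  half+half : ∀ p → ½ ℚ.* p ℚ.+ ½ ℚ.* p ≡ p
  half+half p = trans (sym (ℚ.*-distribʳ-+ p ½ ½)) (ℚ.*-identityˡ p)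

  sum-close : ∀ p q r s → ℚ.∣ p ℚ.- r ∣ ℚ.< ½ ℚ.* δ → ℚ.∣ q ℚ.- s ∣ ℚ.< ½ ℚ.* δ →
              ℚ.∣ (p ℚ.+ q) ℚ.- (r ℚ.+ s) ∣ ℚ.< δ
  sum-close {δ} p q r s pr qs = subst₂ ℚ._<_
    (cong ℚ.∣_∣ (solve 4 (λ a b c d → (a :- c) :+ (b :- d) := (a :+ b) :- (c :+ d)) refl p q r s))
    (half+half δ)
    (ℚ.≤-<-trans (ℚ.∣p+q∣≤∣p∣+∣q∣ (p ℚ.- r) (q ℚ.- s)) (ℚ.+-mono-< pr qs))
    where
    open +-*-Solver

  neg-close : ∀ p q → ℚ.∣ ℚ.- p ℚ.- ℚ.- q ∣ ≡ ℚ.∣ p ℚ.- q ∣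
  neg-close p q = trans
    (cong ℚ.∣_∣ (solve 2 (λ a b → :- a :- :- b := b :- a) refl p q)) (∣p-q∣≡∣q-p∣ q p)
    where
    open +-*-Solver

  prod-close : ∀ p q r s (B C : ℚ) → 0ℚ ℚ.< B → 0ℚ ℚ.< C →
               ℚ.∣ p ∣ ℚ.≤ B → ℚ.∣ s ∣ ℚ.≤ C →
               ℚ.∣ p ℚ.- r ∣ ℚ.< δ → ℚ.∣ q ℚ.- s ∣ ℚ.< δ →
               ℚ.∣ p ℚ.* q ℚ.- r ℚ.* s ∣ ℚ.< (B ℚ.+ C) ℚ.* δ
  prod-close {δ} p q r s B C 0<B 0<C p≤B s≤C pr qs = begin-strict
    ℚ.∣ p ℚ.* q ℚ.- r ℚ.* s ∣
      ≡⟨ cong ℚ.∣_∣ (solve 4 (λ a b c d → a :* b :- c :* d := a :* (b :- d) :+ d :* (a :- c)) refl p q r s) ⟩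
    ℚ.∣ p ℚ.* (q ℚ.- s) ℚ.+ s ℚ.* (p ℚ.- r) ∣
      ≤⟨ ℚ.∣p+q∣≤∣p∣+∣q∣ (p ℚ.* (q ℚ.- s)) (s ℚ.* (p ℚ.- r)) ⟩
    ℚ.∣ p ℚ.* (q ℚ.- s) ∣ ℚ.+ ℚ.∣ s ℚ.* (p ℚ.- r) ∣
      ≡⟨ cong₂ ℚ._+_ (ℚ.∣p*q∣≡∣p∣*∣q∣ p (q ℚ.- s)) (ℚ.∣p*q∣≡∣p∣*∣q∣ s (p ℚ.- r)) ⟩
    ℚ.∣ p ∣ ℚ.* ℚ.∣ q ℚ.- s ∣ ℚ.+ ℚ.∣ s ∣ ℚ.* ℚ.∣ p ℚ.- r ∣
      ≤⟨ ℚ.+-mono-≤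
           (ℚ.*-monoʳ-≤-nonNeg ℚ.∣ q ℚ.- s ∣ {{ℚ.∣-∣-nonNeg (q ℚ.- s)}} p≤B)
           (ℚ.*-monoʳ-≤-nonNeg ℚ.∣ p ℚ.- r ∣ {{ℚ.∣-∣-nonNeg (p ℚ.- r)}} s≤C) ⟩
    B ℚ.* ℚ.∣ q ℚ.- s ∣ ℚ.+ C ℚ.* ℚ.∣ p ℚ.- r ∣
      <⟨ ℚ.+-mono-< (ℚ.*-monoʳ-<-pos B {{ℚ.positive 0<B}} qs) (ℚ.*-monoʳ-<-pos C {{ℚ.positive 0<C}} pr) ⟩
    B ℚ.* δ ℚ.+ C ℚ.* δ
      ≡⟨ ℚ.*-distribʳ-+ δ B C ⟨
    (B ℚ.+ C) ℚ.* δ ∎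
    where
    open ℚ.≤-Reasoning
    open +-*-Solver

  shrink : ∀ K → 0ℚ ℚ.< K → ∀ ε → 0ℚ ℚ.< ε → ∃ λ δ → 0ℚ ℚ.< δ × K ℚ.* δ ≡ ε
  shrink K 0<K ε 0<ε = ε ℚ.* 1/K
    , ℚ.positive⁻¹ (ε ℚ.* 1/K) {{ℚ.pos*pos⇒pos ε {{ℚ.positive 0<ε}} 1/K {{ℚ.1/pos⇒pos K {{ℚ.positive 0<K}}}}}}
    , (begin
      K ℚ.* (ε ℚ.* 1/K)  ≡⟨ solve 3 (λ k e i → k :* (e :* i) := e :* (k :* i)) refl K ε 1/K ⟩
      ε ℚ.* (K ℚ.* 1/K)  ≡⟨ cong (ε ℚ.*_) (ℚ.*-inverseʳ K {{K≢0}}) ⟩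
      ε ℚ.* 1ℚ           ≡⟨ ℚ.*-identityʳ ε ⟩
      ε                  ∎)
    where
    open ≡-Reasoning
    open +-*-Solver
    K≢0 = ℚ.>-nonZero 0<K
    1/K = (ℚ.1/ K) {{K≢0}}

  pos+pos : 0ℚ ℚ.< p → 0ℚ ℚ.< q → 0ℚ ℚ.< p ℚ.+ q
  pos+pos 0<p 0<q = ℚ.+-mono-< 0<p 0<q

  pos*pos : 0ℚ ℚ.< p → 0ℚ ℚ.< q → 0ℚ ℚ.< p ℚ.* q
  pos*pos {p} {q} 0<p 0<q = ℚ.positive⁻¹ (p ℚ.* q)
    {{ℚ.pos*pos⇒pos p {{ℚ.positive 0<p}} q {{ℚ.positive 0<q}}}}

  square-cancel-< : ∀ {q p} → 0ℚ ℚ.≤ q → p ℚ.* p ℚ.< q ℚ.* q → p ℚ.< q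
  square-cancel-< {q} {p} 0≤q p²<q² with p ℚ.<? q
  ... | yes p<q = p<q
  ... | no  p≮q = contradiction (ℚ.<-≤-trans p²<q² (ℚ.≤-trans
      (ℚ.*-monoˡ-≤-nonNeg q {{ℚ.nonNegative 0≤q}} q≤p)
      (ℚ.*-monoʳ-≤-nonNeg p {{ℚ.nonNegative (ℚ.≤-trans 0≤q q≤p)}} q≤p)))
      (ℚ.<-irrefl refl)
    where q≤p = ℚ.≮⇒≥ p≮q

  1/suc : ℕ → ℚ
  1/suc k = ℤ.+ 1 ℚ./ suc k

  ι : ℕ → ℚ
  ι n = ℤ.+ n ℚ./ 1

  toℚᵘ-/ : ∀ m k → toℚᵘ (m ℚ./ suc k) ℚᵘ.≃ ℚᵘ.mkℚᵘ m k
  toℚᵘ-/ m k = ℚ.toℚᵘ-fromℚᵘ (ℚᵘ.mkℚᵘ m k)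

  1/suc>0 : ∀ k → 0ℚ ℚ.< 1/suc k
  1/suc>0 k = ℚ.positive⁻¹ (1/suc k) {{ℚ.normalize-pos 1 (suc k)}}

  /-split : ∀ m k → ℤ.+ m ℚ./ suc k ≡ ι m ℚ.* 1/suc k
  /-split m k = ℚ.toℚᵘ-injective (begin
    toℚᵘ (ℤ.+ m ℚ./ suc k)                        ≈⟨ toℚᵘ-/ (ℤ.+ m) k ⟩
    ℚᵘ.mkℚᵘ (ℤ.+ m) k                             ≈⟨ ℚᵘ.*≡* (cong₂ ℤ._*_ (sym (ℤ.*-identityʳ (ℤ.+ m))) (cong ℤ.+_ (ℕ.*-identityˡ (suc k)))) ⟩
    ℚᵘ.mkℚᵘ (ℤ.+ m) 0 ℚᵘ.* ℚᵘ.mkℚᵘ (ℤ.+ 1) k      ≈⟨ ℚᵘ.*-cong (toℚᵘ-/ (ℤ.+ m) 0) (toℚᵘ-/ (ℤ.+ 1) k) ⟨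
    toℚᵘ (ι m) ℚᵘ.* toℚᵘ (1/suc k)                ≈⟨ ℚ.toℚᵘ-homo-* (ι m) (1/suc k) ⟨
    toℚᵘ (ι m ℚ.* 1/suc k)                        ∎)
    where
    open ℚᵘ.≃-Reasoning

  ι-* : ∀ m n → ι (m ℕ.* n) ≡ ι m ℚ.* ι n
  ι-* m n = ℚ.toℚᵘ-injective (begin
    toℚᵘ (ι (m ℕ.* n))                            ≈⟨ toℚᵘ-/ (ℤ.+ (m ℕ.* n)) 0 ⟩
    ℚᵘ.mkℚᵘ (ℤ.+ (m ℕ.* n)) 0                     ≈⟨ ℚᵘ.*≡* (cong (ℤ._* ℤ.+ 1) (ℤ.pos-* m n)) ⟩
    ℚᵘ.mkℚᵘ (ℤ.+ m) 0 ℚᵘ.* ℚᵘ.mkℚᵘ (ℤ.+ n) 0      ≈⟨ ℚᵘ.*-cong (toℚᵘ-/ (ℤ.+ m) 0) (toℚᵘ-/ (ℤ.+ n) 0) ⟨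
    toℚᵘ (ι m) ℚᵘ.* toℚᵘ (ι n)                    ≈⟨ ℚ.toℚᵘ-homo-* (ι m) (ι n) ⟨
    toℚᵘ (ι m ℚ.* ι n)                            ∎)
    where
    open ℚᵘ.≃-Reasoning

  ι-suc : ∀ m → ι (suc m) ≡ 1ℚ ℚ.+ ι m
  ι-suc m = ℚ.toℚᵘ-injective (begin
    toℚᵘ (ι (suc m))                              ≈⟨ toℚᵘ-/ (ℤ.+ suc m) 0 ⟩
    ℚᵘ.mkℚᵘ (ℤ.+ suc m) 0                         ≈⟨ ℚᵘ.*≡* (cong (ℤ._* ℤ.+ 1) (cong (ℤ._+_ (ℤ.+ 1)) (sym (ℤ.*-identityʳ (ℤ.+ m))))) ⟩
    ℚᵘ.mkℚᵘ (ℤ.+ 1) 0 ℚᵘ.+ ℚᵘ.mkℚᵘ (ℤ.+ m) 0      ≈⟨ ℚᵘ.+-cong (ℚᵘ.≃-refl {ℚᵘ.mkℚᵘ (ℤ.+ 1) 0}) (toℚᵘ-/ (ℤ.+ m) 0) ⟨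
    toℚᵘ 1ℚ ℚᵘ.+ toℚᵘ (ι m)                       ≈⟨ ℚ.toℚᵘ-homo-+ 1ℚ (ι m) ⟨
    toℚᵘ (1ℚ ℚ.+ ι m)                             ∎)
    where
    open ℚᵘ.≃-Reasoning

  ι≥0 : ∀ m → 0ℚ ℚ.≤ ι m
  ι≥0 m = ℚ.nonNegative⁻¹ (ι m) {{ℚ.normalize-nonNeg m 1}}

  ι-mono-≤ : ∀ {m n} → m ℕ.≤ n → ι m ℚ.≤ ι n
  ι-mono-≤ {n = n} ℕ.z≤n = ι≥0 n
  ι-mono-≤ {suc m} {suc n} (ℕ.s≤s m≤n) = subst₂ ℚ._≤_ (sym (ι-suc m)) (sym (ι-suc n))
    (ℚ.+-monoʳ-≤ 1ℚ (ι-mono-≤ m≤n))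

  ι-mono-< : ∀ {m n} → m ℕ.< n → ι m ℚ.< ι n
  ι-mono-< {m} m<n = ℚ.<-≤-trans
    (subst₂ ℚ._<_ (ℚ.+-identityˡ (ι m)) (sym (ι-suc m)) (ℚ.+-monoˡ-< (ι m) {0ℚ} {1ℚ} (ℚ.positive⁻¹ 1ℚ)))
    (ι-mono-≤ m<n)

  suc*1/suc : ∀ k → ι (suc k) ℚ.* 1/suc k ≡ 1ℚ
  suc*1/suc k = trans (sym (/-split (suc k) k))
    (ℚ.fromℚᵘ-cong {ℚᵘ.mkℚᵘ (ℤ.+ suc k) k} {ℚᵘ.mkℚᵘ (ℤ.+ 1) 0}
      (ℚᵘ.*≡* (trans (ℤ.*-identityʳ (ℤ.+ suc k)) (sym (ℤ.*-identityˡ (ℤ.+ suc k))))))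

  archimedean : ∀ ε → 0ℚ ℚ.< ε → ∃ λ N → ∀ n → N ℕ.≤ n → 1/suc n ℚ.< ε
  archimedean ε 0<ε with ℚ.positive {ε} 0<ε
  archimedean ε@(ℚ.mkℚ ℤ.+[1+ a ] d _) 0<ε | _ = suc d , λ n N≤n →
    ℚ.toℚᵘ-cancel-< {1/suc n} {ε} (ℚᵘ.<-respˡ-≃ (ℚᵘ.≃-sym (toℚᵘ-/ (ℤ.+ 1) n))
      (ℚᵘ.*<* (subst₂ ℤ._<_ (sym (ℤ.*-identityˡ (ℤ.+ suc d))) (ℤ.pos-* (suc a) (suc n))
        (ℤ.+<+ (ℕ.≤-trans (ℕ.s≤s N≤n) (ℕ.m≤m+n (suc n) (a ℕ.* suc n)))))))

open RationalLemmas

------------------------------------------------------------------------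
-- Real numbers: Cauchy sequences of rationals, with the setoid equality
-- "the difference tends to 0"

record ℝ : Set where
  constructor mkℝ
  field
    seq    : ℕ → ℚ
    cauchy : ∀ ε → 0ℚ ℚ.< ε →
             ∃ λ N → ∀ m n → N ℕ.≤ m → N ℕ.≤ n → ℚ.∣ seq m ℚ.- seq n ∣ ℚ.< ε

open ℝ

infix 4 _≈_

_≈_ : Rel ℝ 0ℓ
x ≈ y = ∀ ε → 0ℚ ℚ.< ε → ∃ λ N → ∀ n → N ℕ.≤ n → ℚ.∣ seq x n ℚ.- seq y n ∣ ℚ.< ε

eventually-≡⇒≈ : ∀ x y N → (∀ n → N ℕ.≤ n → seq x n ≡ seq y n) → x ≈ y
eventually-≡⇒≈ x y N eq ε 0<ε = N , λ n N≤n → subst (ℚ._< ε)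
  (trans (sym (∣p-p∣≡0 (seq y n))) (cong (λ t → ℚ.∣ t ℚ.- seq y n ∣) (sym (eq n N≤n)))) 0<ε

pointwise-≡⇒≈ : ∀ x y → (∀ n → seq x n ≡ seq y n) → x ≈ y
pointwise-≡⇒≈ x y eq = eventually-≡⇒≈ x y 0 (λ n _ → eq n)

≈-refl : ∀ {x} → x ≈ x
≈-refl {x} = pointwise-≡⇒≈ x x (λ _ → refl)

≈-sym : ∀ {x y} → x ≈ y → y ≈ x
≈-sym {x} {y} x≈y ε 0<ε with N , f ← x≈y ε 0<ε =
  N , λ n N≤n → subst (ℚ._< ε) (∣p-q∣≡∣q-p∣ (seq x n) (seq y n)) (f n N≤n)

≈-trans : ∀ {x y z} → x ≈ y → y ≈ z → x ≈ z
≈-trans {x} {y} {z} x≈y y≈z ε 0<ε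
  with N , f ← x≈y (½ ℚ.* ε) (half>0 0<ε) | M , g ← y≈z (½ ℚ.* ε) (half>0 0<ε) =
  N ℕ.⊔ M , λ n le → ℚ.≤-<-trans (triangle (seq x n) (seq y n) (seq z n))
    (subst (_ ℚ.<_) (half+half ε)
      (ℚ.+-mono-< (f n (ℕ.m⊔n≤o⇒m≤o N M le)) (g n (ℕ.m⊔n≤o⇒n≤o N M le))))

eventually-bounded : ∀ x → ∃ λ B → 0ℚ ℚ.< B × ∃ λ N → ∀ n → N ℕ.≤ n → ℚ.∣ seq x n ∣ ℚ.≤ B
eventually-bounded x with N , f ← cauchy x 1ℚ (ℚ.positive⁻¹ 1ℚ) =
  1ℚ ℚ.+ ℚ.∣ seq x N ∣
  , ℚ.+-mono-<-≤ (ℚ.positive⁻¹ 1ℚ) (ℚ.0≤∣p∣ (seq x N))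
  , N , λ n N≤n → ℚ.≤-trans
      (subst (λ t → ℚ.∣ t ∣ ℚ.≤ ℚ.∣ seq x n ℚ.- seq x N ∣ ℚ.+ ℚ.∣ seq x N ∣)
        (solve 2 (λ a b → (a :- b) :+ b := a) refl (seq x n) (seq x N))
        (ℚ.∣p+q∣≤∣p∣+∣q∣ (seq x n ℚ.- seq x N) (seq x N)))
      (ℚ.+-monoˡ-≤ ℚ.∣ seq x N ∣ (ℚ.<⇒≤ (f n N N≤n ℕ.≤-refl)))
  where
  open +-*-Solver

fromℚ : ℚ → ℝ
fromℚ q = mkℝ (λ _ → q) λ ε 0<ε → 0 , λ _ _ _ _ → subst (ℚ._< ε) (sym (∣p-p∣≡0 q)) 0<ε

fromℕ : ℕ → ℝ
fromℕ n = fromℚ (ℤ.+ n ℚ./ 1)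

0ℝ 1ℝ : ℝ
0ℝ = fromℚ 0ℚ
1ℝ = fromℚ 1ℚ

infix  8 -_
infixl 7 _*_
infixl 6 _+_ _-_

_+_ : ℝ → ℝ → ℝ
x + y = mkℝ (λ n → seq x n ℚ.+ seq y n) +-cauchy
  where
  +-cauchy : ∀ ε → 0ℚ ℚ.< ε → ∃ λ N → ∀ m n → N ℕ.≤ m → N ℕ.≤ n →
             ℚ.∣ (seq x m ℚ.+ seq y m) ℚ.- (seq x n ℚ.+ seq y n) ∣ ℚ.< ε
  +-cauchy ε 0<ε with N , f ← cauchy x (½ ℚ.* ε) (half>0 0<ε)
                    | M , g ← cauchy y (½ ℚ.* ε) (half>0 0<ε) =
    N ℕ.⊔ M , λ m n le le′ →
      sum-close (seq x m) (seq y m) (seq x n) (seq y n)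
        (f m n (ℕ.m⊔n≤o⇒m≤o N M le) (ℕ.m⊔n≤o⇒m≤o N M le′))
        (g m n (ℕ.m⊔n≤o⇒n≤o N M le) (ℕ.m⊔n≤o⇒n≤o N M le′))

-_ : ℝ → ℝ
- x = mkℝ (λ n → ℚ.- seq x n) λ ε 0<ε → let N , f = cauchy x ε 0<ε in
  N , λ m n le le′ → subst (ℚ._< ε) (sym (neg-close (seq x m) (seq x n))) (f m n le le′)

_-_ : ℝ → ℝ → ℝ
x - y = x + (- y)

_*_ : ℝ → ℝ → ℝ
x * y = mkℝ (λ n → seq x n ℚ.* seq y n) *-cauchy
  where
  *-cauchy : ∀ ε → 0ℚ ℚ.< ε → ∃ λ N → ∀ m n → N ℕ.≤ m → N ℕ.≤ n →
             ℚ.∣ seq x m ℚ.* seq y m ℚ.- seq x n ℚ.* seq y n ∣ ℚ.< ε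
  *-cauchy ε 0<ε =
    let B , 0<B , N₁ , bx = eventually-bounded x
        C , 0<C , N₂ , by = eventually-bounded y
        δ , 0<δ , eq      = shrink (B ℚ.+ C) (pos+pos 0<B 0<C) ε 0<ε
        N₃ , f            = cauchy x δ 0<δ
        N₄ , g            = cauchy y δ 0<δ
    in (N₁ ℕ.⊔ N₂) ℕ.⊔ (N₃ ℕ.⊔ N₄) , λ m n le le′ →
      let l  = ℕ.m⊔n≤o⇒m≤o (N₁ ℕ.⊔ N₂) (N₃ ℕ.⊔ N₄) le
          r  = ℕ.m⊔n≤o⇒n≤o (N₁ ℕ.⊔ N₂) (N₃ ℕ.⊔ N₄) le
          l′ = ℕ.m⊔n≤o⇒m≤o (N₁ ℕ.⊔ N₂) (N₃ ℕ.⊔ N₄) le′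
          r′ = ℕ.m⊔n≤o⇒n≤o (N₁ ℕ.⊔ N₂) (N₃ ℕ.⊔ N₄) le′
      in subst (ℚ.∣ seq x m ℚ.* seq y m ℚ.- seq x n ℚ.* seq y n ∣ ℚ.<_) eq
        (prod-close (seq x m) (seq y m) (seq x n) (seq y n) B C 0<B 0<C
          (bx m (ℕ.m⊔n≤o⇒m≤o N₁ N₂ l)) (by n (ℕ.m⊔n≤o⇒n≤o N₁ N₂ l′))
          (f m n (ℕ.m⊔n≤o⇒m≤o N₃ N₄ r) (ℕ.m⊔n≤o⇒m≤o N₃ N₄ r′))
          (g m n (ℕ.m⊔n≤o⇒n≤o N₃ N₄ r) (ℕ.m⊔n≤o⇒n≤o N₃ N₄ r′)))

∣_∣ : ℝ → ℝ
∣ x ∣ = mkℝ (λ n → ℚ.∣ seq x n ∣) λ ε 0<ε → let N , f = cauchy x ε 0<ε in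
  N , λ m n le le′ → ℚ.≤-<-trans (∣∣p∣-∣q∣∣≤∣p-q∣ (seq x m) (seq x n)) (f m n le le′)

+-cong : ∀ {x y u v} → x ≈ y → u ≈ v → x + u ≈ y + v
+-cong {x} {y} {u} {v} x≈y u≈v ε 0<ε
  with N , f ← x≈y (½ ℚ.* ε) (half>0 0<ε) | M , g ← u≈v (½ ℚ.* ε) (half>0 0<ε) =
  N ℕ.⊔ M , λ n le → sum-close (seq x n) (seq u n) (seq y n) (seq v n)
    (f n (ℕ.m⊔n≤o⇒m≤o N M le)) (g n (ℕ.m⊔n≤o⇒n≤o N M le))

-‿cong : ∀ {x y} → x ≈ y → - x ≈ - y
-‿cong {x} {y} x≈y ε 0<ε with N , f ← x≈y ε 0<ε =
  N , λ n le → subst (ℚ._< ε) (sym (neg-close (seq x n) (seq y n))) (f n le)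

*-cong : ∀ {x y u v} → x ≈ y → u ≈ v → x * u ≈ y * v
*-cong {x} {y} {u} {v} x≈y u≈v ε 0<ε =
  let B , 0<B , N₁ , bx = eventually-bounded x
      C , 0<C , N₂ , bv = eventually-bounded v
      δ , 0<δ , eq      = shrink (B ℚ.+ C) (pos+pos 0<B 0<C) ε 0<ε
      N₃ , f            = x≈y δ 0<δ
      N₄ , g            = u≈v δ 0<δ
  in (N₁ ℕ.⊔ N₂) ℕ.⊔ (N₃ ℕ.⊔ N₄) , λ n le →
    let l = ℕ.m⊔n≤o⇒m≤o (N₁ ℕ.⊔ N₂) (N₃ ℕ.⊔ N₄) le
        r = ℕ.m⊔n≤o⇒n≤o (N₁ ℕ.⊔ N₂) (N₃ ℕ.⊔ N₄) le
    in subst (ℚ.∣ seq x n ℚ.* seq u n ℚ.- seq y n ℚ.* seq v n ∣ ℚ.<_) eq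
      (prod-close (seq x n) (seq u n) (seq y n) (seq v n) B C 0<B 0<C
        (bx n (ℕ.m⊔n≤o⇒m≤o N₁ N₂ l)) (bv n (ℕ.m⊔n≤o⇒n≤o N₁ N₂ l))
        (f n (ℕ.m⊔n≤o⇒m≤o N₃ N₄ r)) (g n (ℕ.m⊔n≤o⇒n≤o N₃ N₄ r)))

∣-∣-cong : ∀ {x y} → x ≈ y → ∣ x ∣ ≈ ∣ y ∣
∣-∣-cong {x} {y} x≈y ε 0<ε with N , f ← x≈y ε 0<ε =
  N , λ n le → ℚ.≤-<-trans (∣∣p∣-∣q∣∣≤∣p-q∣ (seq x n) (seq y n)) (f n le)

≈-isEquivalence : IsEquivalence _≈_
≈-isEquivalence = record
  { refl  = λ {x} → ≈-refl {x}
  ; sym   = λ {x} {y} → ≈-sym {x} {y}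
  ; trans = λ {x} {y} {z} → ≈-trans {x} {y} {z}
  }

+-*-isCommutativeRing : IsCommutativeRing _≈_ _+_ _*_ -_ 0ℝ 1ℝ
+-*-isCommutativeRing = record
  { isRing = record
    { +-isAbelianGroup = record
      { isGroup = record
        { isMonoid = record
          { isSemigroup = record
            { isMagma = record
              { isEquivalence = ≈-isEquivalence
              ; ∙-cong = λ {x} {y} {u} {v} → +-cong {x} {y} {u} {v}
              }
            ; assoc = λ x y z → pointwise-≡⇒≈ ((x + y) + z) (x + (y + z))
                (λ n → ℚ.+-assoc (seq x n) (seq y n) (seq z n))
            }
          ; identity = (λ x → pointwise-≡⇒≈ (0ℝ + x) x (λ n → ℚ.+-identityˡ (seq x n)))
                     , (λ x → pointwise-≡⇒≈ (x + 0ℝ) x (λ n → ℚ.+-identityʳ (seq x n)))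
          }
        ; inverse = (λ x → pointwise-≡⇒≈ (- x + x) 0ℝ (λ n → ℚ.+-inverseˡ (seq x n)))
                  , (λ x → pointwise-≡⇒≈ (x + - x) 0ℝ (λ n → ℚ.+-inverseʳ (seq x n)))
        ; ⁻¹-cong = λ {x} {y} → -‿cong {x} {y}
        }
      ; comm = λ x y → pointwise-≡⇒≈ (x + y) (y + x) (λ n → ℚ.+-comm (seq x n) (seq y n))
      }
    ; *-cong = λ {x} {y} {u} {v} → *-cong {x} {y} {u} {v}
    ; *-assoc = λ x y z → pointwise-≡⇒≈ ((x * y) * z) (x * (y * z))
        (λ n → ℚ.*-assoc (seq x n) (seq y n) (seq z n))
    ; *-identity = (λ x → pointwise-≡⇒≈ (1ℝ * x) x (λ n → ℚ.*-identityˡ (seq x n)))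
                 , (λ x → pointwise-≡⇒≈ (x * 1ℝ) x (λ n → ℚ.*-identityʳ (seq x n)))
    ; distrib = (λ x y z → pointwise-≡⇒≈ (x * (y + z)) (x * y + x * z)
                  (λ n → ℚ.*-distribˡ-+ (seq x n) (seq y n) (seq z n)))
              , (λ x y z → pointwise-≡⇒≈ ((y + z) * x) (y * x + z * x)
                  (λ n → ℚ.*-distribʳ-+ (seq x n) (seq y n) (seq z n)))
    }
  ; *-comm = λ x y → pointwise-≡⇒≈ (x * y) (y * x) (λ n → ℚ.*-comm (seq x n) (seq y n))
  }

+-*-commutativeRing : CommutativeRing 0ℓ 0ℓ
+-*-commutativeRing = record { isCommutativeRing = +-*-isCommutativeRing }

open import Algebra.Definitions.RawSemiring
  (Semiring.rawSemiring (CommutativeRing.semiring +-*-commutativeRing)) public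
  using (_^_; sum; product)

------------------------------------------------------------------------
-- Reciprocals

-- Apartness from 0, the constructive form of "x ≠ 0".
_#0 : ℝ → Set
x #0 = ∃ λ η → 0ℚ ℚ.< η × ∃ λ N → ∀ n → N ℕ.≤ n → η ℚ.≤ ℚ.∣ seq x n ∣

-- The value at 0 is a dummy: a real apart from 0 has only finitely many
-- zero approximants.
recipℚ : ℚ → ℚ
recipℚ q with q ℚ.≟ 0ℚ
... | yes _   = 0ℚ
... | no  q≢0 = (ℚ.1/ q) {{ℚ.≢-nonZero q≢0}}

recipℚ-inverseʳ : ∀ q {η} → 0ℚ ℚ.< η → η ℚ.≤ ℚ.∣ q ∣ → q ℚ.* recipℚ q ≡ 1ℚ
recipℚ-inverseʳ q 0<η η≤∣q∣ with q ℚ.≟ 0ℚ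
... | yes refl = contradiction (ℚ.<-≤-trans 0<η η≤∣q∣) (ℚ.<-irrefl refl)
... | no  q≢0  = ℚ.*-inverseʳ q {{ℚ.≢-nonZero q≢0}}

recipℚ-close : ∀ p q {η ε} → 0ℚ ℚ.< η → η ℚ.≤ ℚ.∣ p ∣ → η ℚ.≤ ℚ.∣ q ∣ →
               ℚ.∣ p ℚ.- q ∣ ℚ.< η ℚ.* η ℚ.* ε → ℚ.∣ recipℚ p ℚ.- recipℚ q ∣ ℚ.< ε
recipℚ-close p q {η} {ε} 0<η η≤p η≤q close =
  ℚ.*-cancelˡ-<-nonNeg (η ℚ.* η) {{ℚ.nonNegative (ℚ.<⇒≤ (pos*pos 0<η 0<η))}} (begin-strict
    η ℚ.* η ℚ.* D
      ≤⟨ ℚ.*-monoʳ-≤-nonNeg D {{D≥0}} (ℚ.≤-trans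
           (ℚ.*-monoʳ-≤-nonNeg η {{ℚ.nonNegative (ℚ.<⇒≤ 0<η)}} η≤p)
           (ℚ.*-monoˡ-≤-nonNeg ℚ.∣ p ∣ {{ℚ.∣-∣-nonNeg p}} η≤q)) ⟩
    ℚ.∣ p ∣ ℚ.* ℚ.∣ q ∣ ℚ.* D
      ≡⟨ cong (ℚ._* D) (ℚ.∣p*q∣≡∣p∣*∣q∣ p q) ⟨
    ℚ.∣ p ℚ.* q ∣ ℚ.* D
      ≡⟨ ℚ.∣p*q∣≡∣p∣*∣q∣ (p ℚ.* q) (recipℚ p ℚ.- recipℚ q) ⟨
    ℚ.∣ p ℚ.* q ℚ.* (recipℚ p ℚ.- recipℚ q) ∣
      ≡⟨ cong ℚ.∣_∣ (solve 4 (λ a b c d → a :* b :* (c :- d) := b :* (a :* c) :- a :* (b :* d)) refl p q (recipℚ p) (recipℚ q)) ⟩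
    ℚ.∣ q ℚ.* (p ℚ.* recipℚ p) ℚ.- p ℚ.* (q ℚ.* recipℚ q) ∣
      ≡⟨ cong₂ (λ s t → ℚ.∣ q ℚ.* s ℚ.- p ℚ.* t ∣) (recipℚ-inverseʳ p 0<η η≤p) (recipℚ-inverseʳ q 0<η η≤q) ⟩
    ℚ.∣ q ℚ.* 1ℚ ℚ.- p ℚ.* 1ℚ ∣
      ≡⟨ cong₂ (λ s t → ℚ.∣ s ℚ.- t ∣) (ℚ.*-identityʳ q) (ℚ.*-identityʳ p) ⟩
    ℚ.∣ q ℚ.- p ∣
      ≡⟨ ∣p-q∣≡∣q-p∣ q p ⟩
    ℚ.∣ p ℚ.- q ∣
      <⟨ close ⟩
    η ℚ.* η ℚ.* ε ∎)
  where
  open ℚ.≤-Reasoning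
  open +-*-Solver
  D = ℚ.∣ recipℚ p ℚ.- recipℚ q ∣
  D≥0 = ℚ.∣-∣-nonNeg (recipℚ p ℚ.- recipℚ q)

1/ : (x : ℝ) → x #0 → ℝ
1/ x (η , 0<η , N , bound) = mkℝ (λ n → recipℚ (seq x n)) λ ε 0<ε →
  let M , f = cauchy x (η ℚ.* η ℚ.* ε) (pos*pos (pos*pos 0<η 0<η) 0<ε) in
  N ℕ.⊔ M , λ m n le le′ → recipℚ-close (seq x m) (seq x n) 0<η
    (bound m (ℕ.m⊔n≤o⇒m≤o N M le)) (bound n (ℕ.m⊔n≤o⇒m≤o N M le′))
    (f m n (ℕ.m⊔n≤o⇒n≤o N M le) (ℕ.m⊔n≤o⇒n≤o N M le′))

*-inverseʳ : ∀ x (x#0 : x #0) → x * 1/ x x#0 ≈ 1ℝ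
*-inverseʳ x x#0@(η , 0<η , N , bound) = eventually-≡⇒≈ (x * 1/ x x#0) 1ℝ N
  (λ n le → recipℚ-inverseʳ (seq x n) 0<η (bound n le))

------------------------------------------------------------------------
-- Square roots of natural numbers

⌊√_⌋ : ℕ → ℕ
⌊√ zero  ⌋ = 0
⌊√ suc n ⌋ with suc ⌊√ n ⌋ ℕ.* suc ⌊√ n ⌋ ℕ.≤? suc n
... | yes _ = suc ⌊√ n ⌋
... | no  _ = ⌊√ n ⌋

⌊√⌋-lower : ∀ n → ⌊√ n ⌋ ℕ.* ⌊√ n ⌋ ℕ.≤ n
⌊√⌋-lower zero    = ℕ.z≤n
⌊√⌋-lower (suc n) with suc ⌊√ n ⌋ ℕ.* suc ⌊√ n ⌋ ℕ.≤? suc n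
... | yes le = le
... | no  _  = ℕ.m≤n⇒m≤1+n (⌊√⌋-lower n)

⌊√⌋-upper : ∀ n → n ℕ.< suc ⌊√ n ⌋ ℕ.* suc ⌊√ n ⌋
⌊√⌋-upper zero    = ℕ.s≤s ℕ.z≤n
⌊√⌋-upper (suc n) with suc ⌊√ n ⌋ ℕ.* suc ⌊√ n ⌋ ℕ.≤? suc n
... | yes _  = ℕ.≤-<-trans (⌊√⌋-upper n)
                 (ℕ.*-mono-< (ℕ.n<1+n (suc ⌊√ n ⌋)) (ℕ.n<1+n (suc ⌊√ n ⌋)))
... | no  ¬le = ℕ.≰⇒> ¬le

-- Truncation of √d to a multiple of 1/(k+1).
√-approx : ℕ → ℕ → ℚ
√-approx d k = ℤ.+ ⌊√ d ℕ.* (suc k ℕ.* suc k) ⌋ ℚ./ suc k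

module _ (d k : ℕ) where
  private
    e = 1/suc k
    K = suc k
    t = ⌊√ d ℕ.* (K ℕ.* K) ⌋
    open +-*-Solver

    scale : ι (d ℕ.* (K ℕ.* K)) ℚ.* (e ℚ.* e) ≡ ι d
    scale = begin
      ι (d ℕ.* (K ℕ.* K)) ℚ.* (e ℚ.* e)
        ≡⟨ cong (ℚ._* (e ℚ.* e)) (trans (ι-* d (K ℕ.* K)) (cong (ι d ℚ.*_) (ι-* K K))) ⟩
      ι d ℚ.* (ι K ℚ.* ι K) ℚ.* (e ℚ.* e)
        ≡⟨ solve 3 (λ a b c → a :* (b :* b) :* (c :* c) := a :* ((b :* c) :* (b :* c))) refl (ι d) (ι K) e ⟩
      ι d ℚ.* ((ι K ℚ.* e) ℚ.* (ι K ℚ.* e))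
        ≡⟨ cong (λ z → ι d ℚ.* (z ℚ.* z)) (suc*1/suc k) ⟩
      ι d ℚ.* (1ℚ ℚ.* 1ℚ)
        ≡⟨ ℚ.*-identityʳ (ι d) ⟩
      ι d ∎
      where
      open ≡-Reasoning

    e²>0 : 0ℚ ℚ.< e ℚ.* e
    e²>0 = pos*pos (1/suc>0 k) (1/suc>0 k)

  √-approx≥0 : 0ℚ ℚ.≤ √-approx d k
  √-approx≥0 = ℚ.nonNegative⁻¹ (√-approx d k) {{ℚ.normalize-nonNeg t K}}

  √-approx-lower : √-approx d k ℚ.* √-approx d k ℚ.≤ ι d
  √-approx-lower = begin
    √-approx d k ℚ.* √-approx d k
      ≡⟨ cong (λ z → z ℚ.* z) (/-split t k) ⟩
    (ι t ℚ.* e) ℚ.* (ι t ℚ.* e)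
      ≡⟨ solve 2 (λ a b → (a :* b) :* (a :* b) := (a :* a) :* (b :* b)) refl (ι t) e ⟩
    (ι t ℚ.* ι t) ℚ.* (e ℚ.* e)
      ≡⟨ cong (ℚ._* (e ℚ.* e)) (ι-* t t) ⟨
    ι (t ℕ.* t) ℚ.* (e ℚ.* e)
      ≤⟨ ℚ.*-monoʳ-≤-nonNeg (e ℚ.* e) {{ℚ.nonNegative (ℚ.<⇒≤ e²>0)}} (ι-mono-≤ (⌊√⌋-lower (d ℕ.* (K ℕ.* K)))) ⟩
    ι (d ℕ.* (K ℕ.* K)) ℚ.* (e ℚ.* e)
      ≡⟨ scale ⟩
    ι d ∎
    where
    open ℚ.≤-Reasoning

  √-approx-upper : ι d ℚ.< (√-approx d k ℚ.+ e) ℚ.* (√-approx d k ℚ.+ e)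
  √-approx-upper = begin-strict
    ι d
      ≡⟨ scale ⟨
    ι (d ℕ.* (K ℕ.* K)) ℚ.* (e ℚ.* e)
      <⟨ ℚ.*-monoˡ-<-pos (e ℚ.* e) {{ℚ.positive e²>0}} (ι-mono-< (⌊√⌋-upper (d ℕ.* (K ℕ.* K)))) ⟩
    ι (suc t ℕ.* suc t) ℚ.* (e ℚ.* e)
      ≡⟨ cong (ℚ._* (e ℚ.* e)) (trans (ι-* (suc t) (suc t)) (cong (λ z → z ℚ.* z) (ι-suc t))) ⟩
    (1ℚ ℚ.+ ι t) ℚ.* (1ℚ ℚ.+ ι t) ℚ.* (e ℚ.* e)
      ≡⟨ solve 2 (λ a b → (con 1ℚ :+ a) :* (con 1ℚ :+ a) :* (b :* b) := (a :* b :+ b) :* (a :* b :+ b)) refl (ι t) e ⟩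
    (ι t ℚ.* e ℚ.+ e) ℚ.* (ι t ℚ.* e ℚ.+ e)
      ≡⟨ cong (λ z → (z ℚ.+ e) ℚ.* (z ℚ.+ e)) (/-split t k) ⟨
    (√-approx d k ℚ.+ e) ℚ.* (√-approx d k ℚ.+ e) ∎
    where
    open ℚ.≤-Reasoning

  √-approx≥1 : .{{ℕ.NonZero d}} → 1ℚ ℚ.≤ √-approx d k
  √-approx≥1 = subst₂ ℚ._≤_ (suc*1/suc k) (sym (/-split t k))
    (ℚ.*-monoʳ-≤-nonNeg e {{ℚ.nonNegative (ℚ.<⇒≤ (1/suc>0 k))}} (ι-mono-≤ K≤t))
    where
    K≤t : K ℕ.≤ t
    K≤t with K ℕ.≤? t
    ... | yes le  = le
    ... | no  ¬le = contradiction (ℕ.<-≤-trans (⌊√⌋-upper (d ℕ.* (K ℕ.* K)))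
            (ℕ.≤-trans (ℕ.*-mono-≤ (ℕ.≰⇒> ¬le) (ℕ.≰⇒> ¬le)) (ℕ.m≤n*m (K ℕ.* K) d)))
            (ℕ.<-irrefl refl)

√-approx-close : ∀ d m n → √-approx d m ℚ.- √-approx d n ℚ.< 1/suc n
√-approx-close d m n = subst (√-approx d m ℚ.- √-approx d n ℚ.<_)
  (solve 2 (λ a b → (a :+ b) :- a := b) refl (√-approx d n) (1/suc n))
  (ℚ.+-monoˡ-< (ℚ.- √-approx d n) (square-cancel-< {√-approx d n ℚ.+ 1/suc n} {√-approx d m}
    (ℚ.+-mono-≤ (√-approx≥0 d n) (ℚ.<⇒≤ (1/suc>0 n)))
    (ℚ.≤-<-trans (√-approx-lower d m) (√-approx-upper d n))))
  where
  open +-*-Solver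

√ : ℕ → ℝ
√ d = mkℝ (√-approx d) λ ε 0<ε → let N , f = archimedean ε 0<ε in
  N , λ m n le le′ → ∣p∣<q
    (ℚ.<-trans (√-approx-close d m n) (f n le′))
    (subst (ℚ._< ε) (solve 2 (λ a b → a :- b := :- (b :- a)) refl (√-approx d n) (√-approx d m))
      (ℚ.<-trans (√-approx-close d n m) (f m le)))
  where
  open +-*-Solver

√-#0 : ∀ d .{{_ : ℕ.NonZero d}} → √ d #0
√-#0 d = 1ℚ , ℚ.positive⁻¹ 1ℚ , 0 , λ n _ →
  ℚ.≤-trans (√-approx≥1 d n) (p≤∣p∣ (√-approx d n))

-- √ d is nonnegative since all its approximants are (√-approx≥0), and it
-- squares to d.
√-square : ∀ d → √ d * √ d ≈ fromℕ d
√-square d ε 0<ε =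
  let B , 0<B , N₁ , bound = eventually-bounded (√ d)
      0<2B+1               = pos+pos (pos+pos 0<B 0<B) (ℚ.positive⁻¹ 1ℚ)
      δ , 0<δ , eq         = shrink (B ℚ.+ B ℚ.+ 1ℚ) 0<2B+1 ε 0<ε
      N₂ , small           = archimedean δ 0<δ
      N₃ , small′          = archimedean 1ℚ (ℚ.positive⁻¹ 1ℚ)
  in N₁ ℕ.⊔ (N₂ ℕ.⊔ N₃) , λ n le →
    let r = ℕ.m⊔n≤o⇒n≤o N₁ (N₂ ℕ.⊔ N₃) le
    in subst (ℚ.∣ √-approx d n ℚ.* √-approx d n ℚ.- ι d ∣ ℚ.<_) eq
      (close n B δ 0<2B+1
        (bound n (ℕ.m⊔n≤o⇒m≤o N₁ (N₂ ℕ.⊔ N₃) le))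
        (small n (ℕ.m⊔n≤o⇒m≤o N₂ N₃ r)) (small′ n (ℕ.m⊔n≤o⇒n≤o N₂ N₃ r)))
  where
  open +-*-Solver
  close : ∀ n B δ → 0ℚ ℚ.< B ℚ.+ B ℚ.+ 1ℚ → ℚ.∣ √-approx d n ∣ ℚ.≤ B →
          1/suc n ℚ.< δ → 1/suc n ℚ.< 1ℚ →
          ℚ.∣ √-approx d n ℚ.* √-approx d n ℚ.- ι d ∣ ℚ.< (B ℚ.+ B ℚ.+ 1ℚ) ℚ.* δ
  close n B δ 0<2B+1 ∣a∣≤B e<δ e<1 = begin-strict
    ℚ.∣ a ℚ.* a ℚ.- ι d ∣
      ≡⟨ ∣p-q∣≡∣q-p∣ (a ℚ.* a) (ι d) ⟩
    ℚ.∣ ι d ℚ.- a ℚ.* a ∣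
      ≡⟨ ℚ.0≤p⇒∣p∣≡p (subst (ℚ._≤ ι d ℚ.- a ℚ.* a) (ℚ.+-inverseʳ (a ℚ.* a))
           (ℚ.+-monoˡ-≤ (ℚ.- (a ℚ.* a)) (√-approx-lower d n))) ⟩
    ι d ℚ.- a ℚ.* a
      <⟨ ℚ.+-monoˡ-< (ℚ.- (a ℚ.* a)) (√-approx-upper d n) ⟩
    (a ℚ.+ e) ℚ.* (a ℚ.+ e) ℚ.- a ℚ.* a
      ≡⟨ solve 2 (λ x y → (x :+ y) :* (x :+ y) :- x :* x := (x :+ x :+ y) :* y) refl a e ⟩
    (a ℚ.+ a ℚ.+ e) ℚ.* e
      ≤⟨ ℚ.*-monoʳ-≤-nonNeg e {{ℚ.nonNegative (ℚ.<⇒≤ (1/suc>0 n))}}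
           (ℚ.+-mono-≤ (ℚ.+-mono-≤ a≤B a≤B) (ℚ.<⇒≤ e<1)) ⟩
    (B ℚ.+ B ℚ.+ 1ℚ) ℚ.* e
      <⟨ ℚ.*-monoʳ-<-pos (B ℚ.+ B ℚ.+ 1ℚ) {{ℚ.positive 0<2B+1}} e<δ ⟩
    (B ℚ.+ B ℚ.+ 1ℚ) ℚ.* δ ∎
    where
    open ℚ.≤-Reasoning
    a = √-approx d n
    e = 1/suc n
    a≤B = ℚ.≤-trans (p≤∣p∣ a) ∣a∣≤B

------------------------------------------------------------------------
-- Matrices and determinants

Matrix : ℕ → Set
Matrix n = Fin n → Fin n → ℝ

δ : ∀ {n} → Matrix n
δ i j with i Fin.≟ j
... | yes _ = 1ℝ
... | no  _ = 0ℝ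

minor : ∀ {n} → Matrix (suc n) → Fin (suc n) → Matrix n
minor A j r c = A (suc r) (punchIn j c)

-- Laplace expansion along the first row.
det : ∀ {n} → Matrix n → ℝ
det {zero}  A = 1ℝ
det {suc n} A = sum (λ j → (- 1ℝ) ^ toℕ j * A zero j * det (minor A j))

charPoly : ∀ {n} → Matrix n → ℝ → ℝ
charPoly A x = det (λ i j → x * δ i j - A i j)

-- ρ lists the eigenvalues of A counted with (algebraic) multiplicity.
IsSpectrum : ∀ {n} → Matrix n → Vector ℝ n → Set
IsSpectrum A ρ = ∀ x → charPoly A x ≈ product (λ i → x - ρ i)

------------------------------------------------------------------------
-- Graphs

record Graph (n : ℕ) : Set₁ where
  infix 4 _∼_ _∼?_
  field
    _∼_      : Rel (Fin n) 0ℓ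
    _∼?_     : Decidable _∼_
    ∼-sym    : Symmetric _∼_
    ∼-irrefl : Irreflexive _≡_ _∼_

  degree : Fin n → ℕ
  degree i = length (filter (i ∼?_) (allFin n))

  degree-nonZero : ∀ {i j} → i ∼ j → ℕ.NonZero (degree i)
  degree-nonZero {i} {j} i∼j = ℕ.>-nonZero (∈-length (∈-filter⁺ (i ∼?_) (∈-allFin j) i∼j))

K : ∀ n → Graph n
K n = record
  { _∼_      = _≢_
  ; _∼?_     = λ i j → ¬? (i Fin.≟ j)
  ; ∼-sym    = λ i≢j → i≢j ∘ sym
  ; ∼-irrefl = λ i≡j i≢j → i≢j i≡j
  }

module _ {n} (G : Graph n) where
  open Graph G

  randićMatrix : Matrix n
  randićMatrix i j with i ∼? j
  ... | yes i∼j = 1/ (√ (degree i ℕ.* degree j)) (√-#0 _ {{ℕ.m*n≢0 (degree i) (degree j)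
                    {{degree-nonZero i∼j}} {{degree-nonZero (∼-sym i∼j)}}}})
  ... | no  _   = 0ℝ

  RP : ℝ → ℝ
  RP = charPoly randićMatrix

  -- RE(G) = e.  The spectrum is determined only up to permutation (and
  -- the setoid equality of ℝ), so this says that the Randić matrix has a
  -- spectrum and that every listing of it has absolute values summing to e.
  HasRandićEnergy : ℝ → Set
  HasRandićEnergy e = ∃ (IsSpectrum randićMatrix)
                    × (∀ ρ → IsSpectrum randićMatrix ρ → sum (λ i → ∣ ρ i ∣) ≈ e)

pred-nonZero : ∀ {n} → 2 ℕ.≤ n → ℕ.NonZero (n ℕ.∸ 1)
pred-nonZero (ℕ.s≤s (ℕ.s≤s _)) = _

{-# OPTIONS --safe #-}
module Submission where

-- All matrix entries involved are given by explicit rational approximants, and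
-- those of 1/√(d d) are exactly 1/d, so the characteristic polynomial of K_n is
-- computed approximant by approximant from the determinant of a rational matrix
-- with one value a on and one value b off the diagonal.  Laplace expansion gives
-- this determinant by induction, together with those of its minors.
--
-- For the energy, let r = 1/(n-1).  An eigenvalue ρ satisfies
-- (ρ - 1)(ρ + r)^(n-1) = 0; since 1 and -r are apart, it is possible to tell
-- which of ρ - 1, ρ + r is apart from 0, and hence ρ is -r or 1.  Evaluating the
-- characteristic polynomial at 2 shows that (2 + r)^l = (2 + r)^(n-1) for the
-- multiplicity l of -r, so l = n - 1 and the energy is 1 + (n-1) r = 2.

open import Defs
import Algebra.Definitions.RawSemiring
open import Data.Fin.Base using (Fin; zero; suc; toℕ; punchIn)
import Data.Fin.Properties as Fin
open import Data.Integer.Base using (+_)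
open import Data.List.Base using (length; filter; tabulate)
open import Data.List.Properties using (filter-all; length-tabulate)
open import Data.List.Relation.Unary.All.Properties using (tabulate⁺)
open import Data.Nat.Base as ℕ using (ℕ; zero; suc; _∸_; _≤_; z≤n; s≤s)
import Data.Nat.Properties as ℕ
open import Data.Product.Base using (∃; ∃₂; _×_; _,_; proj₁; proj₂)
open import Data.Rational.Base as ℚ using (ℚ; 0ℚ; 1ℚ; ½; _/_)
import Data.Rational.Properties as ℚ
open import Data.Rational.Solver using (module +-*-Solver)
open import Data.Sum.Base using (_⊎_; inj₁; inj₂)
open import Data.Vec.Functional using (Vector)
open import Function.Base using (_∘_; id)
open import Relation.Binary.PropositionalEquality using (_≡_; _≢_; refl; sym; trans; cong; cong₂; subst; module ≡-Reasoning)
open import Relation.Nullary using (Dec; ¬_; yes; no; ¬?; contradiction)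

open ℝ
open RationalLemmas
open +-*-Solver using (solve; _:=_; _:+_; _:*_; _:-_; :-_; con)
module ℚΣ = Algebra.Definitions.RawSemiring ℚ.+-*-rawSemiring

-- Determinants of rational matrices

minorℚ : ∀ {n} → (Fin (suc n) → Fin (suc n) → ℚ) → Fin (suc n) → Fin n → Fin n → ℚ
minorℚ A j r c = A (suc r) (punchIn j c)

detℚ : ∀ {n} → (Fin n → Fin n → ℚ) → ℚ
detℚ {zero}  A = 1ℚ
detℚ {suc n} A = ℚΣ.sum (λ j → (ℚ.- 1ℚ) ℚΣ.^ toℕ j ℚ.* A zero j ℚ.* detℚ (minorℚ A j))

sum-cong : ∀ {n} {f g : Vector ℚ n} → (∀ i → f i ≡ g i) → ℚΣ.sum f ≡ ℚΣ.sum g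
sum-cong {zero}  f≡g = refl
sum-cong {suc n} f≡g = cong₂ ℚ._+_ (f≡g zero) (sum-cong (f≡g ∘ suc))

sum-constant : ∀ {n} {f : Vector ℚ n} c → (∀ i → f i ≡ c) → ℚΣ.sum f ≡ ι n ℚ.* c
sum-constant {zero}  c f≡c = sym (ℚ.*-zeroˡ c)
sum-constant {suc n} {f} c f≡c = begin
  f zero ℚ.+ ℚΣ.sum (f ∘ suc)  ≡⟨ cong₂ ℚ._+_ (f≡c zero) (sum-constant c (f≡c ∘ suc)) ⟩
  c ℚ.+ ι n ℚ.* c              ≡⟨ solve 2 (λ c n → c :+ n :* c := (con 1ℚ :+ n) :* c) refl c (ι n) ⟩
  (1ℚ ℚ.+ ι n) ℚ.* c           ≡⟨ cong (ℚ._* c) (ι-suc n) ⟨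
  ι (suc n) ℚ.* c              ∎
  where open ≡-Reasoning

sum-zero : ∀ {n} {f : Vector ℚ n} → (∀ i → f i ≡ 0ℚ) → ℚΣ.sum f ≡ 0ℚ
sum-zero {n} f≡0 = trans (sum-constant 0ℚ f≡0) (ℚ.*-zeroʳ (ι n))

det-cong : ∀ {n} (A B : Fin n → Fin n → ℚ) → (∀ i j → A i j ≡ B i j) → detℚ A ≡ detℚ B
det-cong {zero}  A B A≡B = refl
det-cong {suc n} A B A≡B = sum-cong λ j →
  cong₂ ℚ._*_ (cong ((ℚ.- 1ℚ) ℚΣ.^ toℕ j ℚ.*_) (A≡B zero j)) (det-cong (minorℚ A j) (minorℚ B j) λ r c → A≡B (suc r) (punchIn j c))

-- In the first-row expansion the first two terms cancel: equal entries, equal minors, opposite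
-- signs. Deleting any later column keeps the two equal columns, so the remaining minors vanish by
-- induction on the size.
det-equalColumns : ∀ {n} (A : Fin (suc (suc n)) → Fin (suc (suc n)) → ℚ) →
                   (∀ i → A i zero ≡ A i (suc zero)) → detℚ A ≡ 0ℚ
det-equalColumns {n} A eq = begin
  1ℚ ℚ.* A zero zero ℚ.* d₀ ℚ.+ ((ℚ.- 1ℚ) ℚ.* 1ℚ ℚ.* A zero (suc zero) ℚ.* d₁ ℚ.+ ℚΣ.sum (term A))
    ≡⟨ cong₂ (λ d e → 1ℚ ℚ.* A zero zero ℚ.* d ℚ.+ ((ℚ.- 1ℚ) ℚ.* 1ℚ ℚ.* A zero (suc zero) ℚ.* d₁ ℚ.+ e)) d₀≡d₁ (sum-zero (term-zero A eq)) ⟩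
  1ℚ ℚ.* A zero zero ℚ.* d₁ ℚ.+ ((ℚ.- 1ℚ) ℚ.* 1ℚ ℚ.* A zero (suc zero) ℚ.* d₁ ℚ.+ 0ℚ)
    ≡⟨ cong (λ a → 1ℚ ℚ.* a ℚ.* d₁ ℚ.+ ((ℚ.- 1ℚ) ℚ.* 1ℚ ℚ.* A zero (suc zero) ℚ.* d₁ ℚ.+ 0ℚ)) (eq zero) ⟩
  1ℚ ℚ.* A zero (suc zero) ℚ.* d₁ ℚ.+ ((ℚ.- 1ℚ) ℚ.* 1ℚ ℚ.* A zero (suc zero) ℚ.* d₁ ℚ.+ 0ℚ)
    ≡⟨ solve 2 (λ a d → con 1ℚ :* a :* d :+ ((:- con 1ℚ) :* con 1ℚ :* a :* d :+ con 0ℚ) := con 0ℚ)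
         refl (A zero (suc zero)) d₁ ⟩
  0ℚ ∎
  where
  open ≡-Reasoning
  d₀ = detℚ (minorℚ A zero)
  d₁ = detℚ (minorℚ A (suc zero))
  term : ∀ {n} → (Fin (suc (suc n)) → Fin (suc (suc n)) → ℚ) → Fin n → ℚ
  term A j = (ℚ.- 1ℚ) ℚΣ.^ toℕ (suc (suc j)) ℚ.* A zero (suc (suc j)) ℚ.* detℚ (minorℚ A (suc (suc j)))
  d₀≡d₁ : d₀ ≡ d₁
  d₀≡d₁ = det-cong (minorℚ A zero) (minorℚ A (suc zero)) λ { r zero → sym (eq (suc r)) ; r (suc c) → refl }
  -- Quantified over its own `n` and `A` so that `n` can be split: a third column exists only when
  -- `n` is a successor, and then the minor still has the two columns required by the recursive
  -- call.
  term-zero : ∀ {n} (A : Fin (suc (suc n)) → Fin (suc (suc n)) → ℚ) → (∀ i → A i zero ≡ A i (suc zero)) →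
              ∀ j → term A j ≡ 0ℚ
  term-zero {suc n} A eq j = trans
    (cong ((ℚ.- 1ℚ) ℚΣ.^ toℕ (suc (suc j)) ℚ.* A zero (suc (suc j)) ℚ.*_)
      (det-equalColumns (minorℚ A (suc (suc j))) (eq ∘ suc)))
    (ℚ.*-zeroʳ ((ℚ.- 1ℚ) ℚΣ.^ toℕ (suc (suc j)) ℚ.* A zero (suc (suc j))))

sign-square : ∀ k → (ℚ.- 1ℚ) ℚΣ.^ k ℚ.* (ℚ.- 1ℚ) ℚΣ.^ k ≡ 1ℚ
sign-square zero    = refl
sign-square (suc k) = trans
  (solve 1 (λ s → (:- con 1ℚ) :* s :* ((:- con 1ℚ) :* s) := s :* s) refl ((ℚ.- 1ℚ) ℚΣ.^ k))
  (sign-square k)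

-- Matrices with one value on and one value off the diagonal

module _ (a b : ℚ) where

  -- Recursive instead of testing `i ≡ j`, so that deleting the first row and column gives the
  -- smaller matrix back by computation.
  twoValued : ∀ {n} → Fin n → Fin n → ℚ
  twoValued zero    zero    = a
  twoValued zero    (suc _) = b
  twoValued (suc _) zero    = b
  twoValued (suc i) (suc j) = twoValued i j

  twoValued-diagonal : ∀ {n} (i : Fin n) → twoValued i i ≡ a
  twoValued-diagonal zero    = refl
  twoValued-diagonal (suc i) = twoValued-diagonal i

  twoValued-offDiagonal : ∀ {n} {i j : Fin n} → i ≢ j → twoValued i j ≡ b
  twoValued-offDiagonal {i = zero}  {zero}  i≢j = contradiction refl i≢j
  twoValued-offDiagonal {i = zero}  {suc j} i≢j = refl
  twoValued-offDiagonal {i = suc i} {zero}  i≢j = refl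
  twoValued-offDiagonal {i = suc i} {suc j} i≢j = twoValued-offDiagonal (i≢j ∘ cong suc)

  offMinor : ∀ {n} → Fin n → Fin n → Fin n → ℚ
  offMinor k = minorℚ twoValued (suc k)

  private
    -- The cofactor sign `(-1)^(k+1)` meets the sign `(-1)^k` of the minor, leaving `-1` for every
    -- `k`; hence all terms of the tail are the same.
    tail-expansion : ∀ {n} p → (∀ k → detℚ (offMinor {n} k) ≡ (ℚ.- 1ℚ) ℚΣ.^ toℕ k ℚ.* (b ℚ.* p)) →
      ℚΣ.sum (λ k → (ℚ.- 1ℚ) ℚΣ.^ suc (toℕ k) ℚ.* b ℚ.* detℚ (offMinor {n} k)) ≡ ι n ℚ.* (ℚ.- (b ℚ.* b ℚ.* p))
    tail-expansion p hyp = sum-constant _ λ k → let s = (ℚ.- 1ℚ) ℚΣ.^ toℕ k in begin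
      (ℚ.- 1ℚ) ℚ.* s ℚ.* b ℚ.* detℚ (offMinor k)      ≡⟨ cong ((ℚ.- 1ℚ) ℚ.* s ℚ.* b ℚ.*_) (hyp k) ⟩
      (ℚ.- 1ℚ) ℚ.* s ℚ.* b ℚ.* (s ℚ.* (b ℚ.* p))      ≡⟨ solve 3 (λ s b p → (:- con 1ℚ) :* s :* b :* (s :* (b :* p)) := (s :* s) :* (:- (b :* b :* p))) refl s b p ⟩
      (s ℚ.* s) ℚ.* (ℚ.- (b ℚ.* b ℚ.* p))             ≡⟨ cong (ℚ._* (ℚ.- (b ℚ.* b ℚ.* p))) (sign-square (toℕ k)) ⟩
      1ℚ ℚ.* (ℚ.- (b ℚ.* b ℚ.* p))                    ≡⟨ ℚ.*-identityˡ _ ⟩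
      ℚ.- (b ℚ.* b ℚ.* p)                             ∎
      where open ≡-Reasoning

  mutual
    -- The first-row expansion consists of `a` times the determinant one size down and `n + 1` equal
    -- terms, for the step from `n` to `n + 1`. It closes because `a (a + n b) - (n + 1) b²` factors
    -- as `(a + (n + 1) b) (a - b)`.
    det-twoValued : ∀ n → detℚ (twoValued {suc n}) ≡ (a ℚ.+ ι n ℚ.* b) ℚ.* (a ℚ.- b) ℚΣ.^ n
    det-twoValued zero =
      solve 2 (λ a b → con 1ℚ :* a :* con 1ℚ :+ con 0ℚ := (a :+ con 0ℚ :* b) :* con 1ℚ) refl a b
    det-twoValued (suc n) = begin
      1ℚ ℚ.* a ℚ.* detℚ (twoValued {suc n}) ℚ.+ ℚΣ.sum (λ k → (ℚ.- 1ℚ) ℚΣ.^ suc (toℕ k) ℚ.* b ℚ.* detℚ (offMinor {suc n} k))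
        ≡⟨ cong₂ (λ d e → 1ℚ ℚ.* a ℚ.* d ℚ.+ e) (det-twoValued n) (tail-expansion p (det-offMinor n)) ⟩
      1ℚ ℚ.* a ℚ.* ((a ℚ.+ ι n ℚ.* b) ℚ.* p) ℚ.+ ι (suc n) ℚ.* (ℚ.- (b ℚ.* b ℚ.* p))
        ≡⟨ cong (λ m → 1ℚ ℚ.* a ℚ.* ((a ℚ.+ ι n ℚ.* b) ℚ.* p) ℚ.+ m ℚ.* (ℚ.- (b ℚ.* b ℚ.* p))) (ι-suc n) ⟩
      1ℚ ℚ.* a ℚ.* ((a ℚ.+ ι n ℚ.* b) ℚ.* p) ℚ.+ (1ℚ ℚ.+ ι n) ℚ.* (ℚ.- (b ℚ.* b ℚ.* p))
        ≡⟨ solve 4 (λ a b n p →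
             con 1ℚ :* a :* ((a :+ n :* b) :* p) :+ (con 1ℚ :+ n) :* (:- (b :* b :* p))
             := (a :+ (con 1ℚ :+ n) :* b) :* ((a :- b) :* p)) refl a b (ι n) p ⟩
      (a ℚ.+ (1ℚ ℚ.+ ι n) ℚ.* b) ℚ.* ((a ℚ.- b) ℚ.* p)
        ≡⟨ cong (λ m → (a ℚ.+ m ℚ.* b) ℚ.* ((a ℚ.- b) ℚ.* p)) (ι-suc n) ⟨
      (a ℚ.+ ι (suc n) ℚ.* b) ℚ.* ((a ℚ.- b) ℚ.* p) ∎
      where
      open ≡-Reasoning
      p = (a ℚ.- b) ℚΣ.^ n

    -- For `k = 0` the minor is `twoValued` with its corner replaced by `b`, so the expansion of
    -- `det-twoValued` recurs with leading coefficient `b` instead of `a`. For a successor the first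
    -- row begins `b`, `a`, and both of these entries have the minor `offMinor k`, which yields the
    -- factor `b - a`.
    det-offMinor : ∀ n (k : Fin (suc n)) → detℚ (offMinor k) ≡ (ℚ.- 1ℚ) ℚΣ.^ toℕ k ℚ.* (b ℚ.* (a ℚ.- b) ℚΣ.^ n)
    det-offMinor zero zero =
      solve 1 (λ b → con 1ℚ :* b :* con 1ℚ :+ con 0ℚ := con 1ℚ :* (b :* con 1ℚ)) refl b
    det-offMinor (suc n) zero = begin
      1ℚ ℚ.* b ℚ.* detℚ (twoValued {suc n}) ℚ.+ ℚΣ.sum (λ k → (ℚ.- 1ℚ) ℚΣ.^ suc (toℕ k) ℚ.* b ℚ.* detℚ (minorℚ (offMinor {suc (suc n)} zero) (suc k)))
        ≡⟨ cong (1ℚ ℚ.* b ℚ.* detℚ (twoValued {suc n}) ℚ.+_) (sum-cong {suc n} λ k →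
             cong ((ℚ.- 1ℚ) ℚΣ.^ suc (toℕ k) ℚ.* b ℚ.*_) (det-cong (minorℚ (offMinor zero) (suc k)) (offMinor k) λ { r zero → refl ; r (suc c) → refl })) ⟩
      1ℚ ℚ.* b ℚ.* detℚ (twoValued {suc n}) ℚ.+ ℚΣ.sum (λ k → (ℚ.- 1ℚ) ℚΣ.^ suc (toℕ k) ℚ.* b ℚ.* detℚ (offMinor {suc n} k))
        ≡⟨ cong₂ (λ d e → 1ℚ ℚ.* b ℚ.* d ℚ.+ e) (det-twoValued n) (tail-expansion p (det-offMinor n)) ⟩
      1ℚ ℚ.* b ℚ.* ((a ℚ.+ ι n ℚ.* b) ℚ.* p) ℚ.+ ι (suc n) ℚ.* (ℚ.- (b ℚ.* b ℚ.* p))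
        ≡⟨ cong (λ m → 1ℚ ℚ.* b ℚ.* ((a ℚ.+ ι n ℚ.* b) ℚ.* p) ℚ.+ m ℚ.* (ℚ.- (b ℚ.* b ℚ.* p))) (ι-suc n) ⟩
      1ℚ ℚ.* b ℚ.* ((a ℚ.+ ι n ℚ.* b) ℚ.* p) ℚ.+ (1ℚ ℚ.+ ι n) ℚ.* (ℚ.- (b ℚ.* b ℚ.* p))
        ≡⟨ solve 4 (λ a b n p →
             con 1ℚ :* b :* ((a :+ n :* b) :* p) :+ (con 1ℚ :+ n) :* (:- (b :* b :* p))
             := con 1ℚ :* (b :* ((a :- b) :* p))) refl a b (ι n) p ⟩
      1ℚ ℚ.* (b ℚ.* ((a ℚ.- b) ℚ.* p)) ∎
      where
      open ≡-Reasoning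
      p = (a ℚ.- b) ℚΣ.^ n
    -- Only the first two minors of the expansion survive: the others have
    -- two columns with all entries b.
    det-offMinor (suc n) (suc k) = begin
      1ℚ ℚ.* b ℚ.* detℚ (offMinor k) ℚ.+ ((ℚ.- 1ℚ) ℚ.* 1ℚ ℚ.* a ℚ.* detℚ (minorℚ (offMinor {suc (suc n)} (suc k)) (suc zero)) ℚ.+ ℚΣ.sum (rest n k))
        ≡⟨ cong₂ (λ d e → 1ℚ ℚ.* b ℚ.* detℚ (offMinor k) ℚ.+ ((ℚ.- 1ℚ) ℚ.* 1ℚ ℚ.* a ℚ.* d ℚ.+ e))
             (det-cong (minorℚ (offMinor (suc k)) (suc zero)) (offMinor k) λ { r zero → refl ; r (suc c) → refl }) (sum-zero (rest-zero n k)) ⟩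
      1ℚ ℚ.* b ℚ.* detℚ (offMinor k) ℚ.+ ((ℚ.- 1ℚ) ℚ.* 1ℚ ℚ.* a ℚ.* detℚ (offMinor k) ℚ.+ 0ℚ)
        ≡⟨ cong (λ d → 1ℚ ℚ.* b ℚ.* d ℚ.+ ((ℚ.- 1ℚ) ℚ.* 1ℚ ℚ.* a ℚ.* d ℚ.+ 0ℚ)) (det-offMinor n k) ⟩
      1ℚ ℚ.* b ℚ.* (s ℚ.* (b ℚ.* p)) ℚ.+ ((ℚ.- 1ℚ) ℚ.* 1ℚ ℚ.* a ℚ.* (s ℚ.* (b ℚ.* p)) ℚ.+ 0ℚ)
        ≡⟨ solve 4 (λ a b s p →
             con 1ℚ :* b :* (s :* (b :* p)) :+ ((:- con 1ℚ) :* con 1ℚ :* a :* (s :* (b :* p)) :+ con 0ℚ)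
             := (:- con 1ℚ) :* s :* (b :* ((a :- b) :* p))) refl a b s p ⟩
      (ℚ.- 1ℚ) ℚ.* s ℚ.* (b ℚ.* ((a ℚ.- b) ℚ.* p)) ∎
      where
      open ≡-Reasoning
      p = (a ℚ.- b) ℚΣ.^ n
      s = (ℚ.- 1ℚ) ℚΣ.^ toℕ k
      rest : ∀ n → Fin (suc n) → Fin n → ℚ
      rest n k j = (ℚ.- 1ℚ) ℚΣ.^ toℕ (suc (suc j)) ℚ.* b ℚ.*
        detℚ (minorℚ (offMinor {suc (suc n)} (suc k)) (suc (suc j)))
      rest-zero : ∀ n k j → rest n k j ≡ 0ℚ
      rest-zero (suc n) k j = trans
        (cong ((ℚ.- 1ℚ) ℚΣ.^ toℕ (suc (suc j)) ℚ.* b ℚ.*_)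
          (det-equalColumns (minorℚ (offMinor {suc (suc (suc n))} (suc k)) (suc (suc j))) λ i → refl))
        (ℚ.*-zeroʳ ((ℚ.- 1ℚ) ℚΣ.^ toℕ (suc (suc j)) ℚ.* b))

-- Approximants of real determinants

seq-^ : ∀ x m k → seq (x ^ m) k ≡ seq x k ℚΣ.^ m
seq-^ x zero    k = refl
seq-^ x (suc m) k = cong (seq x k ℚ.*_) (seq-^ x m k)

seq-sum : ∀ {n} (f : Vector ℝ n) k → seq (sum f) k ≡ ℚΣ.sum (λ i → seq (f i) k)
seq-sum {zero}  f k = refl
seq-sum {suc n} f k = cong (seq (f zero) k ℚ.+_) (seq-sum (f ∘ suc) k)

-- A named copy of the summand in the definition of det: conversion between two
-- λ-abstractions here would unfold the Cauchy proofs inside ℝ.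
laplaceTerm : ∀ {n} → Matrix (suc n) → Fin (suc n) → ℝ
laplaceTerm A j = (- 1ℝ) ^ toℕ j * A zero j * det (minor A j)

-- The ring operations of `ℝ` act on approximants, so the expansion passes through index by index.
-- This moves the computation to `ℚ`, where equality is propositional.
seq-det : ∀ {n} (A : Matrix n) k → seq (det A) k ≡ detℚ (λ i j → seq (A i j) k)
seq-det {zero}  A k = refl
seq-det {suc n} A k = trans (seq-sum (laplaceTerm A) k) (sum-cong λ j →
  cong₂ (λ s d → s ℚ.* seq (A zero j) k ℚ.* d) (seq-^ (- 1ℝ) (toℕ j) k) (seq-det (minor A j) k))

-- The Randić matrix

module _ {n} (G : Graph n) where
  open Graph G

  -- The approximants of `1/` do not depend on the apartness proof, so the adjacency proof found by
  -- the decision procedure leaves no trace.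
  seq-randićMatrix-adjacent : ∀ {i j} → i ∼ j → ∀ k →
    seq (randićMatrix G i j) k ≡ recipℚ (√-approx (degree i ℕ.* degree j) k)
  seq-randićMatrix-adjacent {i} {j} i∼j k with i ∼? j
  ... | yes _   = refl
  ... | no  i≁j = contradiction i∼j i≁j

  seq-randićMatrix-nonadjacent : ∀ {i j} → ¬ i ∼ j → ∀ k → seq (randićMatrix G i j) k ≡ 0ℚ
  seq-randićMatrix-nonadjacent {i} {j} i≁j k with i ∼? j
  ... | yes i∼j = contradiction i∼j i≁j
  ... | no  _   = refl

  seq-RP : ∀ x k →
    seq (RP G x) k ≡ detℚ (λ i j → seq x k ℚ.* seq (δ i j) k ℚ.- seq (randićMatrix G i j) k)
  seq-RP x k = seq-det (λ i j → x * δ i j - randićMatrix G i j) k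

-- Degrees, matrix entries and characteristic polynomial of the complete graph

⌊√⌋-square : ∀ m → ⌊√ m ℕ.* m ⌋ ≡ m
⌊√⌋-square m = ℕ.≤-antisym
  (ℕ.≮⇒≥ λ m<t → ℕ.<⇒≱ (ℕ.*-mono-< m<t m<t) (⌊√⌋-lower (m ℕ.* m)))
  (ℕ.≮⇒≥ λ t<m → ℕ.<⇒≱ (⌊√⌋-upper (m ℕ.* m)) (ℕ.*-mono-≤ t<m t<m))

-- Since `d² (k + 1)²` is a perfect square, the truncation loses nothing: the approximants of the
-- root are constant, and not merely convergent to `d`.
√-approx-square : ∀ d k → √-approx (d ℕ.* d) k ≡ ι d
√-approx-square d k = begin
  + ⌊√ d ℕ.* d ℕ.* (suc k ℕ.* suc k) ⌋ / suc k      ≡⟨ cong (λ t → + ⌊√ t ⌋ / suc k) (ℕ.[m*n]*[o*p]≡[m*o]*[n*p] d d (suc k) (suc k)) ⟩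
  + ⌊√ d ℕ.* suc k ℕ.* (d ℕ.* suc k) ⌋ / suc k      ≡⟨ cong (λ t → + t / suc k) (⌊√⌋-square (d ℕ.* suc k)) ⟩
  + (d ℕ.* suc k) / suc k                           ≡⟨ /-split (d ℕ.* suc k) k ⟩
  ι (d ℕ.* suc k) ℚ.* 1/suc k                       ≡⟨ cong (ℚ._* 1/suc k) (ι-* d (suc k)) ⟩
  ι d ℚ.* ι (suc k) ℚ.* 1/suc k                     ≡⟨ ℚ.*-assoc (ι d) (ι (suc k)) (1/suc k) ⟩
  ι d ℚ.* (ι (suc k) ℚ.* 1/suc k)                   ≡⟨ cong (ι d ℚ.*_) (suc*1/suc k) ⟩
  ι d ℚ.* 1ℚ                                        ≡⟨ ℚ.*-identityʳ (ι d) ⟩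
  ι d                                               ∎
  where open ≡-Reasoning

-- Uniqueness of inverses: both sides are inverse to `ι (suc m)`.
recipℚ-ι : ∀ m → recipℚ (ι (suc m)) ≡ 1/suc m
recipℚ-ι m = begin
  c                  ≡⟨ ℚ.*-identityʳ c ⟨
  c ℚ.* 1ℚ           ≡⟨ cong (c ℚ.*_) (suc*1/suc m) ⟨
  c ℚ.* (q ℚ.* e)    ≡⟨ solve 3 (λ c q e → c :* (q :* e) := q :* c :* e) refl c q e ⟩
  q ℚ.* c ℚ.* e      ≡⟨ cong (ℚ._* e) (recipℚ-inverseʳ q (ι-mono-< {0} {suc m} (s≤s z≤n)) (p≤∣p∣ q)) ⟩
  1ℚ ℚ.* e           ≡⟨ ℚ.*-identityˡ e ⟩
  e                  ∎
  where
  open ≡-Reasoning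
  q = ι (suc m)
  c = recipℚ q
  e = 1/suc m

-- Stated for any tabulated list, since the tail of `allFin` is `tabulate suc` and the induction has
-- to pass to `f ∘ suc`. The `suc` on the left accounts for the one rejected element.
length-filter-≢ : ∀ {A : Set} {n} (f : Fin n → A) {P : A → Set} (P? : ∀ a → Dec (P a)) (i : Fin n) →
                  ¬ P (f i) → (∀ j → i ≢ j → P (f j)) →
                  suc (length (filter P? (tabulate f))) ≡ n
length-filter-≢ f P? zero ¬Pi P≢ with P? (f zero)
... | yes Pi = contradiction Pi ¬Pi
... | no  _  = cong suc (trans (cong length (filter-all P? (tabulate⁺ λ j → P≢ (suc j) λ ())))
                 (length-tabulate (f ∘ suc)))
length-filter-≢ f P? (suc i) ¬Pi P≢ with P? (f zero)
... | yes _   = cong suc (length-filter-≢ (f ∘ suc) P? i ¬Pi λ j i≢j → P≢ (suc j) (i≢j ∘ Fin.suc-injective))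
... | no  ¬P0 = contradiction (P≢ zero λ ()) ¬P0

degree-K : ∀ {n} (i : Fin (suc n)) → Graph.degree (K (suc n)) i ≡ n
degree-K i = ℕ.suc-injective
  (length-filter-≢ id (λ j → ¬? (i Fin.≟ j)) i (λ i≢i → i≢i refl) (λ j i≢j → i≢j))

seq-δ-diagonal : ∀ {n} (i : Fin n) k → seq (δ i i) k ≡ 1ℚ
seq-δ-diagonal i k with i Fin.≟ i
... | yes _   = refl
... | no  i≢i = contradiction refl i≢i

seq-δ-offDiagonal : ∀ {n} {i j : Fin n} → i ≢ j → ∀ k → seq (δ i j) k ≡ 0ℚ
seq-δ-offDiagonal {i = i} {j} i≢j k with i Fin.≟ j
... | yes i≡j = contradiction i≡j i≢j
... | no  _   = refl

module _ (m : ℕ) where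

  private
    r = 1/suc m

  seq-randićMatrix-K : ∀ {i j : Fin (suc (suc m))} → i ≢ j → ∀ k → seq (randićMatrix (K (suc (suc m))) i j) k ≡ r
  seq-randićMatrix-K {i} {j} i≢j k = begin
    seq (randićMatrix (K (suc (suc m))) i j) k
      ≡⟨ seq-randićMatrix-adjacent (K (suc (suc m))) {i} {j} i≢j k ⟩
    recipℚ (√-approx (Graph.degree (K (suc (suc m))) i ℕ.* Graph.degree (K (suc (suc m))) j) k)
      ≡⟨ cong₂ (λ d e → recipℚ (√-approx (d ℕ.* e) k)) (degree-K i) (degree-K j) ⟩
    recipℚ (√-approx (suc m ℕ.* suc m) k)
      ≡⟨ cong recipℚ (√-approx-square (suc m) k) ⟩
    recipℚ (ι (suc m))
      ≡⟨ recipℚ-ι m ⟩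
    r ∎
    where open ≡-Reasoning

  seq-characteristicMatrix-K : ∀ x k (i j : Fin (suc (suc m))) →
    seq x k ℚ.* seq (δ i j) k ℚ.- seq (randićMatrix (K (suc (suc m))) i j) k ≡ twoValued (seq x k) (ℚ.- r) i j
  seq-characteristicMatrix-K x k i j = case (i Fin.≟ j)
    where
    open ≡-Reasoning
    ξ = seq x k
    case : Dec (i ≡ j) → ξ ℚ.* seq (δ i j) k ℚ.- seq (randićMatrix (K (suc (suc m))) i j) k ≡ twoValued ξ (ℚ.- r) i j
    case (yes refl) = begin
      ξ ℚ.* seq (δ i i) k ℚ.- seq (randićMatrix (K (suc (suc m))) i i) k
        ≡⟨ cong₂ (λ s t → ξ ℚ.* s ℚ.- t) (seq-δ-diagonal i k) (seq-randićMatrix-nonadjacent (K (suc (suc m))) {i} {i} (λ i≢i → i≢i refl) k) ⟩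
      ξ ℚ.* 1ℚ ℚ.- 0ℚ
        ≡⟨ solve 1 (λ x → x :* con 1ℚ :- con 0ℚ := x) refl ξ ⟩
      ξ
        ≡⟨ twoValued-diagonal ξ (ℚ.- r) i ⟨
      twoValued ξ (ℚ.- r) i i ∎
    case (no i≢j) = begin
      ξ ℚ.* seq (δ i j) k ℚ.- seq (randićMatrix (K (suc (suc m))) i j) k
        ≡⟨ cong₂ (λ s t → ξ ℚ.* s ℚ.- t) (seq-δ-offDiagonal i≢j k) (seq-randićMatrix-K {i} {j} i≢j k) ⟩
      ξ ℚ.* 0ℚ ℚ.- r
        ≡⟨ solve 2 (λ x r → x :* con 0ℚ :- r := :- r) refl ξ r ⟩
      ℚ.- r
        ≡⟨ twoValued-offDiagonal ξ (ℚ.- r) i≢j ⟨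
      twoValued ξ (ℚ.- r) i j ∎

  -- With `a = ξ` and `b = - r`, the row sum `a + (m + 1) b` is `ξ - 1` because `(m + 1) r = 1`. The
  -- identity is exact at each index, so part (i) needs no limit argument.
  seq-RP-K : ∀ x k → seq (RP (K (suc (suc m))) x) k ≡ (seq x k ℚ.- 1ℚ) ℚ.* (seq x k ℚ.+ r) ℚΣ.^ suc m
  seq-RP-K x k = begin
    seq (RP (K (suc (suc m))) x) k
      ≡⟨ seq-RP (K (suc (suc m))) x k ⟩
    detℚ {suc (suc m)} (λ i j → ξ ℚ.* seq (δ i j) k ℚ.- seq (randićMatrix (K (suc (suc m))) i j) k)
      ≡⟨ det-cong {suc (suc m)} _ (twoValued ξ (ℚ.- r)) (seq-characteristicMatrix-K x k) ⟩
    detℚ (twoValued ξ (ℚ.- r) {suc (suc m)})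
      ≡⟨ det-twoValued ξ (ℚ.- r) (suc m) ⟩
    (ξ ℚ.+ ι (suc m) ℚ.* (ℚ.- r)) ℚ.* (ξ ℚ.- (ℚ.- r)) ℚΣ.^ suc m
      ≡⟨ cong₂ (λ s t → s ℚ.* t ℚΣ.^ suc m)
           (trans (solve 3 (λ x c r → x :+ c :* (:- r) := x :- c :* r) refl ξ (ι (suc m)) r)
             (cong (λ t → ξ ℚ.- t) (suc*1/suc m)))
           (solve 2 (λ x r → x :- (:- r) := x :+ r) refl ξ r) ⟩
    (ξ ℚ.- 1ℚ) ℚ.* (ξ ℚ.+ r) ℚΣ.^ suc m ∎
    where
    open ≡-Reasoning
    ξ = seq x k

seq-product : ∀ {n} (f : Vector ℝ n) k → seq (product f) k ≡ ℚΣ.product (λ i → seq (f i) k)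
seq-product {zero}  f k = refl
seq-product {suc n} f k = cong (seq (f zero) k ℚ.*_) (seq-product (f ∘ suc) k)

product-constant : ∀ n c → ℚΣ.product {n} (λ _ → c) ≡ c ℚΣ.^ n
product-constant zero    c = refl
product-constant (suc n) c = cong (c ℚ.*_) (product-constant n c)

product-zero : ∀ {n} (f : Vector ℚ n) i → f i ≡ 0ℚ → ℚΣ.product f ≡ 0ℚ
product-zero f zero    fi≡0 = trans (cong (ℚ._* ℚΣ.product (f ∘ suc)) fi≡0) (ℚ.*-zeroˡ (ℚΣ.product (f ∘ suc)))
product-zero f (suc i) fi≡0 = trans (cong (f zero ℚ.*_) (product-zero (f ∘ suc) i fi≡0)) (ℚ.*-zeroʳ (f zero))

-- Rational sequences with a rational limit

infix 4 _⟶_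

-- The sequence carries no Cauchy proof, so expressions in approximants need not first be packaged
-- as reals.
record _⟶_ (s : ℕ → ℚ) (q : ℚ) : Set where
  constructor limit
  field
    close : ∀ ε → 0ℚ ℚ.< ε → ∃ λ N → ∀ n → N ≤ n → ℚ.∣ s n ℚ.- q ∣ ℚ.< ε

open _⟶_

⟶-cong : ∀ {s t p q} → (∀ n → s n ≡ t n) → p ≡ q → s ⟶ p → t ⟶ q
⟶-cong {p = p} s≡t refl s⟶p = limit λ ε 0<ε → let N , f = close s⟶p ε 0<ε in
  N , λ n N≤n → subst (λ a → ℚ.∣ a ℚ.- p ∣ ℚ.< ε) (s≡t n) (f n N≤n)

⟶-constant : ∀ q → (λ _ → q) ⟶ q
⟶-constant q = limit λ ε 0<ε → 0 , λ _ _ → subst (ℚ._< ε) (sym (∣p-p∣≡0 q)) 0<ε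

⟶-+ : ∀ {s t p q} → s ⟶ p → t ⟶ q → (λ n → s n ℚ.+ t n) ⟶ p ℚ.+ q
⟶-+ {s} {t} {p} {q} s⟶p t⟶q = limit λ ε 0<ε →
  let M , f = close s⟶p (½ ℚ.* ε) (half>0 0<ε)
      N , g = close t⟶q (½ ℚ.* ε) (half>0 0<ε)
  in M ℕ.⊔ N , λ n le → sum-close (s n) (t n) p q
    (f n (ℕ.m⊔n≤o⇒m≤o M N le)) (g n (ℕ.m⊔n≤o⇒n≤o M N le))

⟶-neg : ∀ {s p} → s ⟶ p → (λ n → ℚ.- s n) ⟶ ℚ.- p
⟶-neg {s} {p} s⟶p = limit λ ε 0<ε → let N , f = close s⟶p ε 0<ε in
  N , λ n le → subst (ℚ._< ε) (sym (neg-close (s n) p)) (f n le)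

⟶-∣∣ : ∀ {s p} → s ⟶ p → (λ n → ℚ.∣ s n ∣) ⟶ ℚ.∣ p ∣
⟶-∣∣ {s} {p} s⟶p = limit λ ε 0<ε → let N , f = close s⟶p ε 0<ε in
  N , λ n le → ℚ.≤-<-trans (∣∣p∣-∣q∣∣≤∣p-q∣ (s n) p) (f n le)

⟶-* : ∀ {s t p q} → s ⟶ p → t ⟶ q → (λ n → s n ℚ.* t n) ⟶ p ℚ.* q
⟶-* {s} {t} {p} {q} s⟶p t⟶q = limit λ ε 0<ε →
  let η , 0<η , eq = shrink (B p ℚ.+ B q) (pos+pos (B>0 p) (B>0 q)) ε 0<ε
      N₁ , b       = close s⟶p 1ℚ (ℚ.positive⁻¹ 1ℚ)
      N₂ , f       = close s⟶p η 0<η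
      N₃ , g       = close t⟶q η 0<η
  in N₁ ℕ.⊔ (N₂ ℕ.⊔ N₃) , λ n le →
    let le′ = ℕ.m⊔n≤o⇒n≤o N₁ (N₂ ℕ.⊔ N₃) le
    in subst (ℚ.∣ s n ℚ.* t n ℚ.- p ℚ.* q ∣ ℚ.<_) eq
      (prod-close (s n) (t n) p q (B p) (B q) (B>0 p) (B>0 q)
        (bounded n (b n (ℕ.m⊔n≤o⇒m≤o N₁ (N₂ ℕ.⊔ N₃) le))) (∣∣≤B q)
        (f n (ℕ.m⊔n≤o⇒m≤o N₂ N₃ le′)) (g n (ℕ.m⊔n≤o⇒n≤o N₂ N₃ le′)))
  where
  B : ℚ → ℚ
  B a = 1ℚ ℚ.+ ℚ.∣ a ∣
  B>0 : ∀ a → 0ℚ ℚ.< B a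
  B>0 a = ℚ.+-mono-<-≤ (ℚ.positive⁻¹ 1ℚ) (ℚ.0≤∣p∣ a)
  ∣∣≤B : ∀ a → ℚ.∣ a ∣ ℚ.≤ B a
  ∣∣≤B a = subst (ℚ._≤ B a) (ℚ.+-identityˡ ℚ.∣ a ∣) (ℚ.+-monoˡ-≤ ℚ.∣ a ∣ (ℚ.nonNegative⁻¹ 1ℚ))
  bounded : ∀ n → ℚ.∣ s n ℚ.- p ∣ ℚ.< 1ℚ → ℚ.∣ s n ∣ ℚ.≤ B p
  bounded n s≈p = begin
    ℚ.∣ s n ∣                         ≡⟨ cong ℚ.∣_∣ (solve 2 (λ a b → a := (a :- b) :+ b) refl (s n) p) ⟩
    ℚ.∣ (s n ℚ.- p) ℚ.+ p ∣           ≤⟨ ℚ.∣p+q∣≤∣p∣+∣q∣ (s n ℚ.- p) p ⟩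
    ℚ.∣ s n ℚ.- p ∣ ℚ.+ ℚ.∣ p ∣       ≤⟨ ℚ.+-monoˡ-≤ ℚ.∣ p ∣ (ℚ.<⇒≤ s≈p) ⟩
    B p                               ∎
    where open ℚ.≤-Reasoning

⟶-sum : ∀ {k} {s : Fin k → ℕ → ℚ} {c : Vector ℚ k} → (∀ i → s i ⟶ c i) →
        (λ n → ℚΣ.sum (λ i → s i n)) ⟶ ℚΣ.sum c
⟶-sum {zero}  s⟶c = ⟶-constant 0ℚ
⟶-sum {suc k} s⟶c = ⟶-+ (s⟶c zero) (⟶-sum (s⟶c ∘ suc))

⟶-product : ∀ {k} {s : Fin k → ℕ → ℚ} {c : Vector ℚ k} → (∀ i → s i ⟶ c i) →
            (λ n → ℚΣ.product (λ i → s i n)) ⟶ ℚΣ.product c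
⟶-product {zero}  s⟶c = ⟶-constant 1ℚ
⟶-product {suc k} s⟶c = ⟶-* (s⟶c zero) (⟶-product (s⟶c ∘ suc))

-- Turns a limit statement back into an exact equation: if `p` and `q` differed, the constant
-- distance `∣ p - q ∣` would itself be an `ε` that is never beaten.
constant⟶⇒≡ : ∀ {p q} → (λ _ → p) ⟶ q → p ≡ q
constant⟶⇒≡ {p} {q} p⟶q with 0ℚ ℚ.<? ℚ.∣ p ℚ.- q ∣
... | yes 0<∣p-q∣ with N , f ← close p⟶q ℚ.∣ p ℚ.- q ∣ 0<∣p-q∣ =
  contradiction (f N ℕ.≤-refl) (ℚ.<-irrefl refl)
... | no  0≮∣p-q∣ = begin
  p                    ≡⟨ solve 2 (λ p q → p := (p :- q) :+ q) refl p q ⟩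
  (p ℚ.- q) ℚ.+ q      ≡⟨ cong (ℚ._+ q) (ℚ.∣p∣≡0⇒p≡0 (p ℚ.- q) (ℚ.≤-antisym (ℚ.≮⇒≥ 0≮∣p-q∣) (ℚ.0≤∣p∣ (p ℚ.- q)))) ⟩
  0ℚ ℚ.+ q             ≡⟨ ℚ.+-identityˡ q ⟩
  q                    ∎
  where open ≡-Reasoning

-- Apartness

-- The counterpart of `_#0` for a bare sequence of rationals.
ApartFrom0 : (ℕ → ℚ) → Set
ApartFrom0 s = ∃ λ η → 0ℚ ℚ.< η × ∃ λ N → ∀ n → N ≤ n → η ℚ.≤ ℚ.∣ s n ∣

½p<p : ∀ {p} → 0ℚ ℚ.< p → ½ ℚ.* p ℚ.< p
½p<p {p} 0<p = subst (ℚ._< p) (ℚ.+-identityʳ (½ ℚ.* p))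
  (subst (½ ℚ.* p ℚ.+ 0ℚ ℚ.<_) (half+half p) (ℚ.+-monoʳ-< (½ ℚ.* p) (half>0 0<p)))

-- The alternatives overlap, which makes the choice constructive: past `N` the sequence varies by
-- less than `ε/4`, so comparing the single rational `∣ seq x N ∣` with `ε/2` settles it, with `ε/4`
-- as the bound in the second case.
small-or-apart : ∀ x ε → 0ℚ ℚ.< ε → (∃ λ N → ∀ n → N ≤ n → ℚ.∣ seq x n ∣ ℚ.< ε) ⊎ ApartFrom0 (seq x)
small-or-apart x ε 0<ε with cauchy x (½ ℚ.* (½ ℚ.* ε)) (half>0 (half>0 0<ε))
... | N , f with ℚ.∣ seq x N ∣ ℚ.<? ½ ℚ.* ε
...   | yes small = inj₁ (N , λ n N≤n → begin-strict
  ℚ.∣ seq x n ∣                                        ≡⟨ cong ℚ.∣_∣ (solve 2 (λ a b → a := (a :- b) :+ b) refl (seq x n) (seq x N)) ⟩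
  ℚ.∣ (seq x n ℚ.- seq x N) ℚ.+ seq x N ∣              ≤⟨ ℚ.∣p+q∣≤∣p∣+∣q∣ (seq x n ℚ.- seq x N) (seq x N) ⟩
  ℚ.∣ seq x n ℚ.- seq x N ∣ ℚ.+ ℚ.∣ seq x N ∣          <⟨ ℚ.+-mono-< (ℚ.<-trans (f n N N≤n ℕ.≤-refl) (½p<p (half>0 0<ε))) small ⟩
  ½ ℚ.* ε ℚ.+ ½ ℚ.* ε                                  ≡⟨ half+half ε ⟩
  ε                                                    ∎)
  where open ℚ.≤-Reasoning
...   | no  large = inj₂ (h , half>0 (half>0 0<ε) , N , λ n N≤n → begin
  h                                                    ≡⟨ solve 1 (λ h → h := (h :+ h) :- h) refl h ⟩
  (h ℚ.+ h) ℚ.- h                                      ≡⟨ cong (λ t → t ℚ.- h) (half+half (½ ℚ.* ε)) ⟩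
  ½ ℚ.* ε ℚ.- h                                        ≤⟨ ℚ.+-mono-≤ (ℚ.≮⇒≥ large) (ℚ.neg-antimono-≤ (ℚ.<⇒≤ (f N n ℕ.≤-refl N≤n))) ⟩
  ℚ.∣ seq x N ∣ ℚ.- ℚ.∣ seq x N ℚ.- seq x n ∣          ≤⟨ ∣p∣-∣q∣≤∣p-q∣ (seq x N) (seq x N ℚ.- seq x n) ⟩
  ℚ.∣ seq x N ℚ.- (seq x N ℚ.- seq x n) ∣              ≡⟨ cong ℚ.∣_∣ (solve 2 (λ a b → a :- (a :- b) := b) refl (seq x N) (seq x n)) ⟩
  ℚ.∣ seq x n ∣                                        ∎)
  where
  open ℚ.≤-Reasoning
  h = ½ ℚ.* (½ ℚ.* ε)

apart-cancelˡ : ∀ {s t} → ApartFrom0 s → (λ n → s n ℚ.* t n) ⟶ 0ℚ → t ⟶ 0ℚ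
apart-cancelˡ {s} {t} (η , 0<η , M , η≤∣s∣) st⟶0 = limit λ ε 0<ε →
  let N , small = close st⟶0 (η ℚ.* ε) (pos*pos 0<η 0<ε) in
  M ℕ.⊔ N , λ n le → ℚ.*-cancelˡ-<-nonNeg η {{ℚ.nonNegative (ℚ.<⇒≤ 0<η)}} (begin-strict
    η ℚ.* ℚ.∣ t n ℚ.- 0ℚ ∣           ≡⟨ cong (λ a → η ℚ.* ℚ.∣ a ∣) (ℚ.+-identityʳ (t n)) ⟩
    η ℚ.* ℚ.∣ t n ∣                  ≤⟨ ℚ.*-monoʳ-≤-nonNeg ℚ.∣ t n ∣ {{ℚ.∣-∣-nonNeg (t n)}} (η≤∣s∣ n (ℕ.m⊔n≤o⇒m≤o M N le)) ⟩
    ℚ.∣ s n ∣ ℚ.* ℚ.∣ t n ∣          ≡⟨ ℚ.∣p*q∣≡∣p∣*∣q∣ (s n) (t n) ⟨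
    ℚ.∣ s n ℚ.* t n ∣                ≡⟨ cong ℚ.∣_∣ (ℚ.+-identityʳ (s n ℚ.* t n)) ⟨
    ℚ.∣ s n ℚ.* t n ℚ.- 0ℚ ∣         <⟨ small n (ℕ.m⊔n≤o⇒n≤o M N le) ⟩
    η ℚ.* ε                          ∎)
  where open ℚ.≤-Reasoning

apart-cancelˡ-^ : ∀ {s t} m → ApartFrom0 s → (λ n → s n ℚΣ.^ m ℚ.* t n) ⟶ 0ℚ → t ⟶ 0ℚ
apart-cancelˡ-^ {s} {t} zero    s#0 h = ⟶-cong (λ n → ℚ.*-identityˡ (t n)) refl h
apart-cancelˡ-^ {s} {t} (suc m) s#0 h = apart-cancelˡ-^ m s#0 (apart-cancelˡ s#0
  (⟶-cong (λ n → ℚ.*-assoc (s n) (s n ℚΣ.^ m) (t n)) refl h))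

-- No root is extracted. If `x` were apart from 0, all `m` factors could be cancelled from
-- `x^m * 1`, giving `1 = 0`; so for each `ε` the first alternative of `small-or-apart` holds.
^⟶0⇒⟶0 : ∀ x m → (λ n → seq x n ℚΣ.^ m) ⟶ 0ℚ → seq x ⟶ 0ℚ
^⟶0⇒⟶0 x m x^m⟶0 = limit λ ε 0<ε → small⇒close ε (small-or-apart x ε 0<ε)
  where
  small⇒close : ∀ ε → (∃ λ N → ∀ n → N ≤ n → ℚ.∣ seq x n ∣ ℚ.< ε) ⊎ ApartFrom0 (seq x) →
                ∃ λ N → ∀ n → N ≤ n → ℚ.∣ seq x n ℚ.- 0ℚ ∣ ℚ.< ε
  small⇒close ε (inj₁ (N , small)) = N , λ n N≤n →
    subst (λ a → ℚ.∣ a ∣ ℚ.< ε) (sym (ℚ.+-identityʳ (seq x n))) (small n N≤n)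
  small⇒close ε (inj₂ x#0) with () ← constant⟶⇒≡ {1ℚ} {0ℚ} (apart-cancelˡ-^ m x#0
    (⟶-cong (λ n → sym (ℚ.*-identityʳ (seq x n ℚΣ.^ m))) refl x^m⟶0))

-- If `y` is eventually within `½` of `1`, then `y + r` is eventually at least `½`, as `r` is
-- nonnegative.
apart-from-1-or-negative : ∀ y {r} → 0ℚ ℚ.≤ r →
  ApartFrom0 (λ n → seq y n ℚ.- 1ℚ) ⊎ ApartFrom0 (λ n → seq y n ℚ.+ r)
apart-from-1-or-negative y {r} 0≤r = cases (small-or-apart (y - 1ℝ) ½ (ℚ.positive⁻¹ ½))
  where
  open ℚ.≤-Reasoning
  cases : (∃ λ N → ∀ n → N ≤ n → ℚ.∣ seq y n ℚ.- 1ℚ ∣ ℚ.< ½) ⊎ ApartFrom0 (λ n → seq y n ℚ.- 1ℚ) →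
          ApartFrom0 (λ n → seq y n ℚ.- 1ℚ) ⊎ ApartFrom0 (λ n → seq y n ℚ.+ r)
  cases (inj₂ apart)       = inj₁ apart
  cases (inj₁ (N , small)) = inj₂ (½ , ℚ.positive⁻¹ ½ , N , λ n N≤n → let η = seq y n in begin
    ½                              ≡⟨ ℚ.+-identityʳ ½ ⟨
    ½ ℚ.+ 0ℚ                       ≤⟨ ℚ.+-monoʳ-≤ ½ 0≤r ⟩
    1ℚ ℚ.- ½ ℚ.+ r                 ≤⟨ ℚ.+-monoˡ-≤ r (ℚ.+-monoʳ-≤ 1ℚ (ℚ.neg-antimono-≤ (ℚ.<⇒≤ (small n N≤n)))) ⟩
    1ℚ ℚ.- ℚ.∣ η ℚ.- 1ℚ ∣ ℚ.+ r    ≡⟨ cong (λ t → 1ℚ ℚ.- t ℚ.+ r) (∣p-q∣≡∣q-p∣ η 1ℚ) ⟩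
    1ℚ ℚ.- ℚ.∣ 1ℚ ℚ.- η ∣ ℚ.+ r    ≤⟨ ℚ.+-monoˡ-≤ r (ℚ.+-monoʳ-≤ 1ℚ (ℚ.neg-antimono-≤ (p≤∣p∣ (1ℚ ℚ.- η)))) ⟩
    1ℚ ℚ.- (1ℚ ℚ.- η) ℚ.+ r        ≡⟨ solve 2 (λ y r → con 1ℚ :- (con 1ℚ :- y) :+ r := y :+ r) refl η r ⟩
    η ℚ.+ r                        ≤⟨ p≤∣p∣ (η ℚ.+ r) ⟩
    ℚ.∣ η ℚ.+ r ∣                  ∎)

roots : ∀ y {r} m → 0ℚ ℚ.≤ r → (λ n → (seq y n ℚ.- 1ℚ) ℚ.* (seq y n ℚ.+ r) ℚΣ.^ m) ⟶ 0ℚ →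
        seq y ⟶ 1ℚ ⊎ seq y ⟶ ℚ.- r
roots y {r} m 0≤r h = cases (apart-from-1-or-negative y 0≤r)
  where
  y-1 y+r : ℕ → ℚ
  y-1 n = seq y n ℚ.- 1ℚ
  y+r n = seq y n ℚ.+ r
  cases : ApartFrom0 y-1 ⊎ ApartFrom0 y+r → seq y ⟶ 1ℚ ⊎ seq y ⟶ ℚ.- r
  cases (inj₁ y-1#0) = inj₂ (⟶-cong
    (λ n → solve 2 (λ y r → (y :+ r) :+ (:- r) := y) refl (seq y n) r) (ℚ.+-identityˡ (ℚ.- r))
    -- `^⟶0⇒⟶0` relies on the Cauchy property, hence the real `y + fromℚ r`, whose approximants are
    -- `y+r`.
    (⟶-+ (^⟶0⇒⟶0 (y + fromℚ r) m (apart-cancelˡ {y-1} {λ n → y+r n ℚΣ.^ m} y-1#0 h)) (⟶-constant (ℚ.- r))))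
  cases (inj₂ y+r#0) = inj₁ (⟶-cong
    (λ n → solve 1 (λ y → (y :- con 1ℚ) :+ con 1ℚ := y) refl (seq y n)) (ℚ.+-identityˡ 1ℚ)
    (⟶-+ (apart-cancelˡ-^ {y+r} {y-1} m y+r#0
        (⟶-cong (λ n → ℚ.*-comm (y-1 n) (y+r n ℚΣ.^ m)) refl h))
      (⟶-constant 1ℚ)))

-- Spectra with eigenvalues 1 and -r

module _ {q : ℚ} (1<q : 1ℚ ℚ.< q) where

  private
    0<q : 0ℚ ℚ.< q
    0<q = ℚ.<-trans (ℚ.positive⁻¹ 1ℚ) 1<q

    q≤q*p : ∀ {p} → 1ℚ ℚ.≤ p → q ℚ.≤ q ℚ.* p
    q≤q*p {p} 1≤p = subst (ℚ._≤ q ℚ.* p) (ℚ.*-identityʳ q)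
      (ℚ.*-monoˡ-≤-nonNeg q {{ℚ.nonNegative (ℚ.<⇒≤ 0<q)}} 1≤p)

    *-cancelˡ-≡ : ∀ {s t} → q ℚ.* s ≡ q ℚ.* t → s ≡ t
    *-cancelˡ-≡ eq = ℚ.≤-antisym
      (ℚ.*-cancelˡ-≤-pos q {{ℚ.positive 0<q}} (ℚ.≤-reflexive eq))
      (ℚ.*-cancelˡ-≤-pos q {{ℚ.positive 0<q}} (ℚ.≤-reflexive (sym eq)))

  1≤^ : ∀ m → 1ℚ ℚ.≤ q ℚΣ.^ m
  1≤^ zero    = ℚ.≤-refl
  1≤^ (suc m) = ℚ.≤-trans (ℚ.<⇒≤ 1<q) (q≤q*p (1≤^ m))

  1<^suc : ∀ m → 1ℚ ℚ.< q ℚΣ.^ suc m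
  1<^suc m = ℚ.<-≤-trans 1<q (q≤q*p (1≤^ m))

  ^-injective : ∀ m n → q ℚΣ.^ m ≡ q ℚΣ.^ n → m ≡ n
  ^-injective zero    zero    eq = refl
  ^-injective zero    (suc n) eq = contradiction (1<^suc n) (ℚ.<-irrefl eq)
  ^-injective (suc m) zero    eq = contradiction (1<^suc m) (ℚ.<-irrefl (sym eq))
  ^-injective (suc m) (suc n) eq = cong suc (^-injective m n (*-cancelˡ-≡ eq))

-- Here `k` counts the values `1` and `l` the values `- r`. At 2 a value `1` contributes the factor
-- `2 - 1 = 1`, so the product depends on `l` alone and can be used to determine it.
multiplicities : ∀ {n r} → 0ℚ ℚ.≤ r → (c : Vector ℚ n) → (∀ i → c i ≡ 1ℚ ⊎ c i ≡ ℚ.- r) →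
  ∃₂ λ k l → k ℕ.+ l ≡ n
           × ℚΣ.product (λ i → ι 2 ℚ.- c i) ≡ (ι 2 ℚ.+ r) ℚΣ.^ l
           × ℚΣ.sum (λ i → ℚ.∣ c i ∣) ≡ ι k ℚ.+ ι l ℚ.* r
multiplicities {zero} {r} 0≤r c c-value = 0 , 0 , refl , refl
  , solve 1 (λ r → con 0ℚ := con 0ℚ :+ con 0ℚ :* r) refl r
multiplicities {suc n} {r} 0≤r c c-value with multiplicities 0≤r (c ∘ suc) (c-value ∘ suc) | c-value zero
... | k , l , k+l≡n , prod , Σ∣c∣ | inj₁ c₀≡1 = suc k , l , cong suc k+l≡n
  , trans (cong₂ (λ s t → (ι 2 ℚ.- s) ℚ.* t) c₀≡1 prod) (ℚ.*-identityˡ _)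
  , (begin
    ℚ.∣ c zero ∣ ℚ.+ ℚΣ.sum (λ i → ℚ.∣ c (suc i) ∣)  ≡⟨ cong₂ (λ s t → ℚ.∣ s ∣ ℚ.+ t) c₀≡1 Σ∣c∣ ⟩
    1ℚ ℚ.+ (ι k ℚ.+ ι l ℚ.* r)                       ≡⟨ ℚ.+-assoc 1ℚ (ι k) (ι l ℚ.* r) ⟨
    1ℚ ℚ.+ ι k ℚ.+ ι l ℚ.* r                         ≡⟨ cong (ℚ._+ ι l ℚ.* r) (ι-suc k) ⟨
    ι (suc k) ℚ.+ ι l ℚ.* r                          ∎)
  where open ≡-Reasoning
... | k , l , k+l≡n , prod , Σ∣c∣ | inj₂ c₀≡-r = k , suc l , trans (ℕ.+-suc k l) (cong suc k+l≡n)
  , trans (cong₂ (λ s t → (ι 2 ℚ.- s) ℚ.* t) c₀≡-r prod)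
      (cong (λ t → (ι 2 ℚ.+ t) ℚ.* (ι 2 ℚ.+ r) ℚΣ.^ l) (solve 1 (λ r → :- (:- r) := r) refl r))
  , (begin
    ℚ.∣ c zero ∣ ℚ.+ ℚΣ.sum (λ i → ℚ.∣ c (suc i) ∣)  ≡⟨ cong₂ (λ s t → ℚ.∣ s ∣ ℚ.+ t) c₀≡-r Σ∣c∣ ⟩
    ℚ.∣ ℚ.- r ∣ ℚ.+ (ι k ℚ.+ ι l ℚ.* r)              ≡⟨ cong (ℚ._+ (ι k ℚ.+ ι l ℚ.* r)) (trans (ℚ.∣-p∣≡∣p∣ r) (ℚ.0≤p⇒∣p∣≡p 0≤r)) ⟩
    r ℚ.+ (ι k ℚ.+ ι l ℚ.* r)                        ≡⟨ solve 3 (λ r k l → r :+ (k :+ l :* r) := k :+ (con 1ℚ :+ l) :* r) refl r (ι k) (ι l) ⟩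
    ι k ℚ.+ (1ℚ ℚ.+ ι l) ℚ.* r                       ≡⟨ cong (λ t → ι k ℚ.+ t ℚ.* r) (ι-suc l) ⟨
    ι k ℚ.+ ι (suc l) ℚ.* r                          ∎)
  where open ≡-Reasoning

module _ {m : ℕ} {r : ℚ} (0≤r : 0ℚ ℚ.≤ r) (ρ : Vector ℝ (suc m))
  (factorisation : ∀ x → (λ k → (seq x k ℚ.- 1ℚ) ℚ.* (seq x k ℚ.+ r) ℚΣ.^ m ℚ.- ℚΣ.product (λ i → seq x k ℚ.- seq (ρ i) k)) ⟶ 0ℚ)
  where

  private
    Eigenvalue : Fin (suc m) → Set
    Eigenvalue i = ∃ λ c → seq (ρ i) ⟶ c × (c ≡ 1ℚ ⊎ c ≡ ℚ.- r)

    eigenvalue : ∀ i → Eigenvalue i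
    -- At `x = ρ i` the product contains the factor `ρ i - ρ i`, which is zero at every index; what
    -- remains says that `(ρ i - 1) (ρ i + r)^m` tends to 0.
    eigenvalue i = cases (roots (ρ i) m 0≤r (⟶-cong vanish refl (factorisation (ρ i))))
      where
      p : ℕ → ℚ
      p k = (seq (ρ i) k ℚ.- 1ℚ) ℚ.* (seq (ρ i) k ℚ.+ r) ℚΣ.^ m
      vanish : ∀ k → p k ℚ.- ℚΣ.product (λ j → seq (ρ i) k ℚ.- seq (ρ j) k) ≡ p k
      vanish k = trans
        (cong (λ t → p k ℚ.- t) (product-zero (λ j → seq (ρ i) k ℚ.- seq (ρ j) k) i (ℚ.+-inverseʳ (seq (ρ i) k))))
        (ℚ.+-identityʳ (p k))
      cases : seq (ρ i) ⟶ 1ℚ ⊎ seq (ρ i) ⟶ ℚ.- r → Eigenvalue i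
      cases (inj₁ ρ⟶1)  = 1ℚ , ρ⟶1 , inj₁ refl
      cases (inj₂ ρ⟶-r) = ℚ.- r , ρ⟶-r , inj₂ refl

    c : Vector ℚ (suc m)
    c i = proj₁ (eigenvalue i)

    ρ⟶c : ∀ i → seq (ρ i) ⟶ c i
    ρ⟶c i = proj₁ (proj₂ (eigenvalue i))

    1<2+r : 1ℚ ℚ.< ι 2 ℚ.+ r
    1<2+r = ℚ.+-mono-<-≤ {1ℚ} {ι 2} (ι-mono-< {1} {2} (s≤s (s≤s z≤n))) 0≤r

    -- The characteristic polynomial at x = 2 determines the multiplicities:
    -- there the factors are 2 - 1 = 1 and 2 + r > 1.
    value-at-2 : (ι 2 ℚ.+ r) ℚΣ.^ m ≡ ℚΣ.product (λ i → ι 2 ℚ.- c i)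
    value-at-2 = constant⟶⇒≡ (⟶-cong
      (λ k → solve 2 (λ a b → (con 1ℚ :* a :- b) :+ b := a) refl ((ι 2 ℚ.+ r) ℚΣ.^ m) (ℚΣ.product (λ i → ι 2 ℚ.- seq (ρ i) k)))
      (ℚ.+-identityˡ _)
      (⟶-+ (factorisation (fromℕ 2)) (⟶-product λ i → ⟶-+ (⟶-constant (ι 2)) (⟶-neg (ρ⟶c i)))))

    sum-c : ℚΣ.sum (λ i → ℚ.∣ c i ∣) ≡ 1ℚ ℚ.+ ι m ℚ.* r
    sum-c = count (multiplicities 0≤r c (λ i → proj₂ (proj₂ (eigenvalue i))))
      where
      count : (∃₂ λ k l → k ℕ.+ l ≡ suc m
                × ℚΣ.product (λ i → ι 2 ℚ.- c i) ≡ (ι 2 ℚ.+ r) ℚΣ.^ l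
                × ℚΣ.sum (λ i → ℚ.∣ c i ∣) ≡ ι k ℚ.+ ι l ℚ.* r) →
              ℚΣ.sum (λ i → ℚ.∣ c i ∣) ≡ 1ℚ ℚ.+ ι m ℚ.* r
      count (k , l , k+l≡1+m , product≡ , sum≡) = trans sum≡ (cong₂ (λ k l → ι k ℚ.+ ι l ℚ.* r) k≡1 l≡m)
        where
        l≡m : l ≡ m
        l≡m = ^-injective 1<2+r l m (sym (trans value-at-2 product≡))
        k≡1 : k ≡ 1
        k≡1 = ℕ.+-cancelʳ-≡ m k 1 (trans (cong (k ℕ.+_) (sym l≡m)) k+l≡1+m)

  sum-∣spectrum∣ : (λ k → ℚΣ.sum (λ i → ℚ.∣ seq (ρ i) k ∣)) ⟶ 1ℚ ℚ.+ ι m ℚ.* r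
  sum-∣spectrum∣ = ⟶-cong (λ _ → refl) sum-c (⟶-sum λ i → ⟶-∣∣ (ρ⟶c i))

-- Polynomial, spectrum and energy of the complete graph

∣p-q∣<ε : ∀ {p q ε} → p ≡ q → 0ℚ ℚ.< ε → ℚ.∣ p ℚ.- q ∣ ℚ.< ε
∣p-q∣<ε {p} refl = subst (ℚ._< _) (sym (∣p-p∣≡0 p))

module _ (m : ℕ) where

  private
    r = 1/suc m

  -- With q and d abstract, so that (x + fromℚ q) ^ d is never compared up to
  -- conversion with the instance in which n ∸ 1 and the NonZero proof occur.
  RP-K : ∀ q d → q ≡ r → d ≡ suc m → ∀ x →
         RP (K (suc (suc m))) x ≈ (x - 1ℝ) * (x + fromℚ q) ^ d
  RP-K q d refl refl x ε 0<ε = 0 , λ k _ → ∣p-q∣<ε (trans (seq-RP-K m x k)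
    (cong ((seq x k ℚ.- 1ℚ) ℚ.*_) (sym (seq-^ (x + fromℚ r) (suc m) k)))) 0<ε

  spectrum-K : Vector ℝ (suc (suc m))
  spectrum-K zero    = 1ℝ
  spectrum-K (suc _) = fromℚ (ℚ.- r)

  seq-product-spectrum-K : ∀ x k → seq (product (λ i → x - spectrum-K i)) k ≡ (seq x k ℚ.- 1ℚ) ℚ.* (seq x k ℚ.+ r) ℚΣ.^ suc m
  seq-product-spectrum-K x k = begin
    seq (product (λ i → x - spectrum-K i)) k       ≡⟨ seq-product (λ i → x - spectrum-K i) k ⟩
    (ξ ℚ.- 1ℚ) ℚ.* ℚΣ.product {suc m} (λ _ → ξ ℚ.- (ℚ.- r))   ≡⟨ cong ((ξ ℚ.- 1ℚ) ℚ.*_) (product-constant (suc m) (ξ ℚ.- (ℚ.- r))) ⟩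
    (ξ ℚ.- 1ℚ) ℚ.* (ξ ℚ.- (ℚ.- r)) ℚΣ.^ suc m      ≡⟨ cong (λ t → (ξ ℚ.- 1ℚ) ℚ.* (ξ ℚ.+ t) ℚΣ.^ suc m) (solve 1 (λ r → :- (:- r) := r) refl r) ⟩
    (ξ ℚ.- 1ℚ) ℚ.* (ξ ℚ.+ r) ℚΣ.^ suc m            ∎
    where
    open ≡-Reasoning
    ξ = seq x k

  isSpectrum-K : IsSpectrum (randićMatrix (K (suc (suc m)))) spectrum-K
  isSpectrum-K x ε 0<ε = 0 , λ k _ →
    ∣p-q∣<ε (trans (seq-RP-K m x k) (sym (seq-product-spectrum-K x k))) 0<ε

  energy-K : ∀ ρ → IsSpectrum (randićMatrix (K (suc (suc m)))) ρ → sum (λ i → ∣ ρ i ∣) ≈ fromℕ 2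
  -- Being `≈` to a constant real unfolds to the field `close`. The limit `1 + (m + 1) r` becomes
  -- `1 + 1`, which computes to the rational 2.
  energy-K ρ ρ-spectrum = close (⟶-cong
    (λ k → sym (seq-sum (λ i → ∣ ρ i ∣) k)) (cong (1ℚ ℚ.+_) (suc*1/suc m))
    (sum-∣spectrum∣ (ℚ.<⇒≤ (1/suc>0 m)) ρ factorisation))
    where
    module _ (x : ℝ) where
      difference : ℕ → ℚ
      difference k = (seq x k ℚ.- 1ℚ) ℚ.* (seq x k ℚ.+ r) ℚΣ.^ suc m ℚ.- ℚΣ.product (λ i → seq x k ℚ.- seq (ρ i) k)

      difference-RP : ∀ k → ℚ.∣ seq (RP (K (suc (suc m))) x) k ℚ.- seq (product (λ i → x - ρ i)) k ∣ ≡ ℚ.∣ difference k ℚ.- 0ℚ ∣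
      difference-RP k = trans
        (cong₂ (λ s t → ℚ.∣ s ℚ.- t ∣) (seq-RP-K m x k) (seq-product (λ i → x - ρ i) k))
        (cong ℚ.∣_∣ (sym (ℚ.+-identityʳ (difference k))))

      factorisation : difference ⟶ 0ℚ
      factorisation = limit λ ε 0<ε → let N , f = ρ-spectrum x ε 0<ε in
        N , λ k N≤k → subst (ℚ._< ε) (difference-RP k) (f k N≤k)

theorem4 : (n : ℕ) (2≤n : 2 ≤ n) →
    (∀ x → RP (K n) x ≈ (x - 1ℝ) * (x + fromℚ (_/_ (+ 1) (n ∸ 1) {{pred-nonZero 2≤n}})) ^ (n ∸ 1))
    × HasRandićEnergy (K n) (fromℕ 2)
theorem4 (suc (suc m)) 2≤n@(s≤s (s≤s _)) =
  RP-K m (_/_ (+ 1) (suc (suc m) ∸ 1) {{pred-nonZero 2≤n}}) (suc (suc m) ∸ 1) refl refl ,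
  (spectrum-K m , isSpectrum-K m) ,
  energy-K m
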